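{- Let $\theta(n)$ denote the maximum interval colouring thickness of a graph on $n$ vertices, and $\theta'(m)$ the maximum interval colouring thickness of a graph with $m$ edges. Then $\theta(n) \leq n^{5/6+o(1)}$ and $\theta'(m) \leq m^{5/11+o(1)}$.
   Context: All graphs are finite and simple. A graph $G$ is interval colourable if it admits an interval colouring: a proper edge-colouring $c\colon E(G)\to\mathbb{N}$ such that for every vertex $v$, the set $\{c(vw)\colon w\in N(v)\}$ consists of consecutive integers. The interval colouring thickness $\theta(G)$ of a graph $G$ is the minimum $k$ such that $E(G)$ can be partitioned into the edge sets of $k$ interval colourable subgraphs. $\theta(n)=\max\{\theta(G): |V(G)|=n\}$ and $\theta'(m)=\max\{\theta(G): |E(G)|=m\}$. The $o(1)$ terms are as $n\to\infty$ and $m\to\infty$ respectively. -}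

module Defs where

open import Data.Nat using (ℕ; zero; suc; _+_; _*_; _^_; _≤_)
open import Data.Fin using (Fin; _<?_)
open import Data.Bool using (Bool; true; false; _∧_; if_then_else_)
open import Data.List using (List; map; allFin)
open import Data.Nat.ListAction using (sum)
open import Data.Product using (Σ; ∃; ∃-syntax; _×_; _,_)
open import Relation.Nullary using (¬_)
open import Relation.Nullary.Decidable using (⌊_⌋)
open import Relation.Binary.PropositionalEquality using (_≡_; _≢_)

record Graph (n : ℕ) : Set where
  field
    adj    : Fin n → Fin n → Bool
    sym    : ∀ u v → adj u v ≡ adj v u
    irrefl : ∀ u → adj u u ≡ false
open Graph public

Edge : ∀ {n} → Graph n → Fin n → Fin n → Set
Edge G u v = adj G u v ≡ true

edgeCount : ∀ {n} → Graph n → ℕ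
edgeCount {n} G =
  sum (map (λ u → sum (map (λ v → if adj G u v ∧ ⌊ u <? v ⌋ then 1 else 0)
                             (allFin n)))
           (allFin n))

-- Interval colouring of the graph whose edge relation is E (given as a
-- symmetric relation on Fin n).  c u v is the colour of edge uv.
IsIntervalColouring : ∀ {n} → (Fin n → Fin n → Set) → (Fin n → Fin n → ℕ) → Set
IsIntervalColouring {n} E c =
  (∀ u v → E u v → c u v ≡ c v u)
  × (∀ v w w' → E v w → E v w' → w ≢ w' → c v w ≢ c v w')
  × (∀ v a b x → E v a → E v b → c v a ≤ x → x ≤ c v b →
       ∃[ w ] (E v w × c v w ≡ x))

IntervalColourable : ∀ {n} → (Fin n → Fin n → Set) → Set
IntervalColourable {n} E = ∃[ c ] IsIntervalColouring E c

-- θ(G) ≤ k : E(G) partitions into the edge sets of k interval colourable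
-- subgraphs (class of edge uv given by p u v).
ThicknessAtMost : ∀ {n} → Graph n → ℕ → Set
ThicknessAtMost {n} G k =
  Σ (Fin n → Fin n → Fin k) λ p →
    (∀ u v → Edge G u v → p u v ≡ p v u)
    × (∀ (i : Fin k) → IntervalColourable (λ u v → Edge G u v × p u v ≡ i))

{-# OPTIONS --safe #-}
module Submission where

-- Call a pair of disjoint vertex sets A, B with |A| = |B| = s dense if it maximises
-- E³ / s⁵, E = e(A,B), among balanced pairs of subsets.  For s not too small,
-- maximality bounds all degrees from below by (13/20) E/s, and bounds e(X,T) from
-- above by (16/25) |T| E/s when |X| ≤ |T| and |X| ≤ s/2; as 13/20 > 16/25, every S × T
-- with |S| + |T| > s spans at least (E/100s) min(|S|,|T|) edges.  Hence Hall's condition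
-- survives the removal of fewer than E/100s perfect matchings, and matchings found
-- greedily form an interval colourable graph with at least E/100 edges.  Starting from
-- a large cut of a graph with V/2 edges and N non-isolated vertices, E is at least of
-- order V⁶/N¹⁰.  A star forest gives another interval colourable subgraph with at least
-- N/4 edges.  So some interval colourable subgraph has f edges with V⁶ = O(f N¹⁰) and
-- N = O(f), hence V¹² = O(f¹² n¹⁰) and V¹¹ = O(f¹¹ V⁵).  Removing such subgraphs greedily
-- takes O(V/f · log V) steps, that is O(n^(5/6) log n), respectively O(m^(5/11) log m).

open import Defs hiding (sym)
open import Data.Nat
open import Data.Nat.Properties
open import Data.Nat.DivMod using (m≡m%n+[m/n]*n; m%n<n; m/n*n≤m; m*n/n≡m; /-monoˡ-≤)
open import Data.Nat.ListAction using (sum)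
open import Data.Nat.Solver using (module +-*-Solver)
open import Data.Fin as Fin using (Fin; zero; suc)
import Data.Fin.Properties as Fin
open import Data.Fin.Subset using (Subset; _∈_; _⊆_; _∪_; _∩_; ∁; ⁅_⁆)
open import Data.Fin.Subset.Properties using (anySubset?; _∈?_; _⊆?_; ⊆-refl; ⊆-trans; x∈⁅y⁆⇒x≡y)
open import Data.Bool using (Bool; true; false; _∧_; _∨_; _xor_; not; if_then_else_)
import Data.Bool.Properties as Bool
open import Data.List as List using (allFin)
import Data.List.Properties as List
open import Data.Vec using (lookup; tabulate)
open import Data.Vec.Properties using (lookup∘tabulate; lookup-zipWith; lookup-map; lookup-replicate; []=⇒lookup; lookup⇒[]=)
open import Data.Product using (Σ; ∃₂; ∃-syntax; _×_; _,_; proj₁; proj₂)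
open import Data.Sum using (_⊎_; inj₁; inj₂)
open import Data.Empty using (⊥; ⊥-elim)
open import Data.Unit using (tt)
open import Function using (_∘_; flip)
open import Relation.Nullary using (¬_; Dec; yes; no; contradiction)
open import Relation.Nullary.Decidable using (⌊_⌋; _×-dec_; ¬?)
open import Relation.Binary.PropositionalEquality hiding (J)

-- The exponent in E / s^(5/3) is a compromise. For a general exponent α, deleting one vertex on
-- each side shows that all degrees are at least about (α - 1) E/s, while comparison with a balanced
-- subpair of side at most s/2 bounds e(X,T) by 2^(1-α) |T| E/s. Expansion needs α - 1 > 2^(1-α),
-- which fails for α ≤ 1.64 and holds for α = 5/3 with little room: 13/20 and 16/25 lie between the
-- two sides. A smaller α would give better bounds. As E ≤ s², the density of the pair yields V² =
-- O(f^(2-α) N^(2α)), and N = O(f) turns this into V/f = O(n^(α/2)) and V/f = O(V^(α/(2+α))). For α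
-- = 5/3 these exponents are 5/6 and 5/11. The star forest is indispensable here: a dense pair may
-- miss most vertices, and only N = O(f) lets powers of N be traded for powers of f.

private
  variable
    n : ℕ

-- Finite sums

∑ : (Fin n → ℕ) → ℕ
∑ {zero}  f = 0
∑ {suc n} f = f zero + ∑ (f ∘ suc)

∑-cong : {f g : Fin n → ℕ} → (∀ i → f i ≡ g i) → ∑ f ≡ ∑ g
∑-cong {zero}  p = refl
∑-cong {suc n} p = cong₂ _+_ (p zero) (∑-cong (p ∘ suc))

∑-mono : {f g : Fin n → ℕ} → (∀ i → f i ≤ g i) → ∑ f ≤ ∑ g
∑-mono {zero}  p = z≤n
∑-mono {suc n} p = +-mono-≤ (p zero) (∑-mono (p ∘ suc))

+-interchange : ∀ a b c d → (a + b) + (c + d) ≡ (a + c) + (b + d)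
+-interchange = solve 4 (λ a b c d → (a :+ b) :+ (c :+ d) := (a :+ c) :+ (b :+ d)) refl
  where open +-*-Solver

*-exchange : ∀ x y z → x * (y * z) ≡ y * (x * z)
*-exchange = solve 3 (λ x y z → x :* (y :* z) := y :* (x :* z)) refl
  where open +-*-Solver

∑-+ : (f g : Fin n → ℕ) → ∑ (λ i → f i + g i) ≡ ∑ f + ∑ g
∑-+ {zero}  f g = refl
∑-+ {suc n} f g = trans (cong (f zero + g zero +_) (∑-+ (f ∘ suc) (g ∘ suc)))
  (+-interchange (f zero) (g zero) _ _)

∑-*ˡ : ∀ c (f : Fin n → ℕ) → ∑ (λ i → c * f i) ≡ c * ∑ f
∑-*ˡ {zero}  c f = sym (*-zeroʳ c)
∑-*ˡ {suc n} c f = trans (cong (c * f zero +_) (∑-*ˡ c (f ∘ suc)))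
  (sym (*-distribˡ-+ c (f zero) _))

∑-zero : {f : Fin n → ℕ} → (∀ i → f i ≡ 0) → ∑ f ≡ 0
∑-zero {zero}  p = refl
∑-zero {suc n} p = cong₂ _+_ (p zero) (∑-zero (p ∘ suc))

∑-swap : ∀ {m} (f : Fin m → Fin n → ℕ) → ∑ (λ i → ∑ (f i)) ≡ ∑ (λ j → ∑ (λ i → f i j))
∑-swap {n = n} {zero}  f = sym (∑-zero {n} {λ _ → 0} (λ _ → refl))
∑-swap {n = n} {suc m} f = trans (cong (∑ (f zero) +_) (∑-swap (f ∘ suc)))
  (sym (∑-+ (f zero) (λ j → ∑ (λ i → f (suc i) j))))

f≤∑f : (f : Fin n → ℕ) → ∀ i → f i ≤ ∑ f
f≤∑f f zero    = m≤m+n _ _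
f≤∑f f (suc i) = ≤-trans (f≤∑f (f ∘ suc) i) (m≤n+m _ _)

f+f≤∑f : (f : Fin n → ℕ) → ∀ {i j} → i ≢ j → f i + f j ≤ ∑ f
f+f≤∑f f {zero}  {zero}  ne = contradiction refl ne
f+f≤∑f f {zero}  {suc j} ne = +-monoʳ-≤ (f zero) (f≤∑f (f ∘ suc) j)
f+f≤∑f f {suc i} {zero}  ne = ≤-trans (≤-reflexive (+-comm (f (suc i)) (f zero)))
  (+-monoʳ-≤ (f zero) (f≤∑f (f ∘ suc) i))
f+f≤∑f f {suc i} {suc j} ne =
  ≤-trans (f+f≤∑f (f ∘ suc) (ne ∘ cong suc)) (m≤n+m _ _)

0<∑⇒∃ : (f : Fin n → ℕ) → 0 < ∑ f → ∃[ i ] 0 < f i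
0<∑⇒∃ {zero} f ()
0<∑⇒∃ {suc n} f p with f zero in eq
... | suc k = zero , subst (0 <_) (sym eq) z<s
... | zero = let i , q = 0<∑⇒∃ (f ∘ suc) p in suc i , q

∑<∑⇒∃ : (f g : Fin n → ℕ) → ∑ f < ∑ g → ∃[ i ] f i < g i
∑<∑⇒∃ {zero} f g ()
∑<∑⇒∃ {suc n} f g p with f zero <? g zero
... | yes q = zero , q
... | no q = let i , r = ∑<∑⇒∃ (f ∘ suc) (g ∘ suc) (+-cancelˡ-< (g zero) _ _
                             (≤-<-trans (+-monoˡ-≤ _ (≮⇒≥ q)) p))
             in suc i , r

⟦_⟧ : Bool → ℕ
⟦ b ⟧ = if b then 1 else 0

⟦⟧≤1 : ∀ b → ⟦ b ⟧ ≤ 1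
⟦⟧≤1 true  = ≤-refl
⟦⟧≤1 false = z≤n

0<⟦⟧ : ∀ {b} → 0 < ⟦ b ⟧ → b ≡ true
0<⟦⟧ {true} _ = refl

⟦true⟧ : ∀ {b} → b ≡ true → ⟦ b ⟧ ≡ 1
⟦true⟧ refl = refl

-- Finite sets

χ : Subset n → Fin n → ℕ
χ S i = ⟦ lookup S i ⟧

# : Subset n → ℕ
# S = ∑ (χ S)

∑∈ : Subset n → (Fin n → ℕ) → ℕ
∑∈ S f = ∑ (λ i → χ S i * f i)

∈⇒χ : {S : Subset n} {i : Fin n} → i ∈ S → χ S i ≡ 1
∈⇒χ p = cong ⟦_⟧ ([]=⇒lookup p)

0<χ⇒∈ : {S : Subset n} {i : Fin n} → 0 < χ S i → i ∈ S
0<χ⇒∈ {S = S} {i} p = lookup⇒[]= i S (0<⟦⟧ p)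

χ≤1 : (S : Subset n) (i : Fin n) → χ S i ≤ 1
χ≤1 S i = ⟦⟧≤1 (lookup S i)

χ-mono : {S T : Subset n} → S ⊆ T → ∀ i → χ S i ≤ χ T i
χ-mono {S = S} {T} p i with lookup S i in eq
... | false = z≤n
... | true  = ≤-reflexive (sym (∈⇒χ (p (lookup⇒[]= i S eq))))

#-mono : {S T : Subset n} → S ⊆ T → # S ≤ # T
#-mono {S = S} {T} p = ∑-mono (χ-mono {S = S} {T} p)

∑∈-cong : (S : Subset n) {f g : Fin n → ℕ} → (∀ i → f i ≡ g i) → ∑∈ S f ≡ ∑∈ S g
∑∈-cong S p = ∑-cong (λ i → cong (χ S i *_) (p i))

∑∈-mono : (S : Subset n) {f g : Fin n → ℕ} → (∀ i → i ∈ S → f i ≤ g i) → ∑∈ S f ≤ ∑∈ S g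
∑∈-mono S {f} {g} p = ∑-mono λ i → aux i
  where
  aux : ∀ i → χ S i * f i ≤ χ S i * g i
  aux i with lookup S i in eq
  ... | false = z≤n
  ... | true  = +-monoˡ-≤ 0 (p i (lookup⇒[]= i S eq))

∑∈-*ˡ : (S : Subset n) → ∀ c (f : Fin n → ℕ) → ∑∈ S (λ i → c * f i) ≡ c * ∑∈ S f
∑∈-*ˡ S c f = trans (∑-cong λ i → *-exchange (χ S i) c (f i)) (∑-*ˡ c (λ i → χ S i * f i))

∑∈-const : (S : Subset n) → ∀ c → ∑∈ S (λ _ → c) ≡ c * # S
∑∈-const S c = trans (∑-cong λ i → *-comm (χ S i) c) (∑-*ˡ c (χ S))

∑∈≤∑ : (S : Subset n) (f : Fin n → ℕ) → ∑∈ S f ≤ ∑ f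
∑∈≤∑ S f = ∑-mono λ i → ≤-trans (*-monoˡ-≤ (f i) (⟦⟧≤1 (lookup S i))) (≤-reflexive (+-identityʳ (f i)))

-- As indicators are at most 1, this one equation expresses both that the parts are disjoint and
-- that they cover `A`; in this form sums split by linearity.
record Split (A S X : Subset n) : Set where
  constructor mkSplit
  field χ-split : ∀ i → χ A i ≡ χ S i + χ X i
open Split

module _ {A S X : Subset n} (sp : Split A S X) where

  split-⊆ˡ : S ⊆ A
  split-⊆ˡ {i} p = 0<χ⇒∈ (subst (0 <_) (sym (trans (χ-split sp i) (cong (_+ χ X i) (∈⇒χ p)))) z<s)

  split-swap : Split A X S
  split-swap = mkSplit λ i → trans (χ-split sp i) (+-comm (χ S i) _)

  split-disjoint : ∀ {i} → i ∈ S → i ∈ X → ⊥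
  split-disjoint {i} p q with χ≤1 A i
  ... | r rewrite χ-split sp i | ∈⇒χ p | ∈⇒χ q = contradiction r λ { (s≤s ()) }

  split-cover : ∀ {i} → i ∈ A → i ∈ S ⊎ i ∈ X
  split-cover {i} p with i ∈? S
  ... | yes q = inj₁ q
  ... | no q with χ S i in eq
  ...   | suc _ = contradiction (0<χ⇒∈ (subst (0 <_) (sym eq) z<s)) q
  ...   | zero = inj₂ (0<χ⇒∈ (subst (0 <_) (trans (sym (∈⇒χ p)) (trans (χ-split sp i) (cong (_+ χ X i) eq))) z<s))

  split-card : # A ≡ # S + # X
  split-card = trans (∑-cong (χ-split sp)) (∑-+ (χ S) (χ X))

  split-∑∈ : ∀ f → ∑∈ A f ≡ ∑∈ S f + ∑∈ X f
  split-∑∈ f = trans (∑-cong λ i → trans (cong (_* f i) (χ-split sp i)) (*-distribʳ-+ (f i) (χ S i) (χ X i)))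
    (∑-+ (λ i → χ S i * f i) (λ i → χ X i * f i))

split-⊆ʳ : {A S X : Subset n} → Split A S X → X ⊆ A
split-⊆ʳ sp = split-⊆ˡ (split-swap sp)

_∖_ : Subset n → Subset n → Subset n
A ∖ S = A ∩ ∁ S

∖-split : {A S : Subset n} → S ⊆ A → Split A S (A ∖ S)
∖-split {A = A} {S} p = mkSplit aux
  where
  aux : ∀ i → χ A i ≡ χ S i + χ (A ∖ S) i
  aux i rewrite lookup-zipWith _∧_ i A (∁ S) | lookup-map i not S with lookup S i in eq
  ... | true  rewrite []=⇒lookup (p (lookup⇒[]= i S eq)) = refl
  ... | false rewrite Bool.∧-identityʳ (lookup A i) = refl

∪-split : {S T : Subset n} → (∀ {i} → i ∈ S → i ∈ T → ⊥) → Split (S ∪ T) S T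
∪-split {S = S} {T} p = mkSplit aux
  where
  aux : ∀ i → χ (S ∪ T) i ≡ χ S i + χ T i
  aux i rewrite lookup-zipWith _∨_ i S T with lookup S i in eq | lookup T i in eq′
  ... | true  | true  = ⊥-elim (p (lookup⇒[]= i S eq) (lookup⇒[]= i T eq′))
  ... | true  | false = refl
  ... | false | _     = refl

⁅⁆⊆ : ∀ {v : Fin n} {A} → v ∈ A → ⁅ v ⁆ ⊆ A
⁅⁆⊆ {v = v} {A} p q = subst (_∈ A) (sym (x∈⁅y⁆⇒x≡y v q)) p

∑∈-⁅⁆ : ∀ (v : Fin n) (f : Fin n → ℕ) → ∑∈ ⁅ v ⁆ f ≡ f v
∑∈-⁅⁆ {suc n} zero f = trans (cong₂ _+_ (+-identityʳ (f zero))
    (∑-zero λ i → cong (λ b → ⟦ b ⟧ * f (suc i)) (lookup-replicate i false)))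
  (+-identityʳ (f zero))
∑∈-⁅⁆ (suc v) f = ∑∈-⁅⁆ v (f ∘ suc)

#-⁅⁆ : ∀ (v : Fin n) → # ⁅ v ⁆ ≡ 1
#-⁅⁆ v = trans (∑-cong λ i → sym (*-identityʳ (χ ⁅ v ⁆ i))) (∑∈-⁅⁆ v (λ _ → 1))

∃-below-average : (S : Subset n) (f : Fin n → ℕ) → 0 < # S →
  ∃[ v ] (v ∈ S × # S * f v ≤ ∑∈ S f)
∃-below-average S f pos
  with Fin.any? (λ v → (v ∈? S) ×-dec (# S * f v ≤? ∑∈ S f))
... | yes r = r
... | no none = contradiction total (<-irrefl refl)
  where
  open ≤-Reasoning
  above : ∀ v → v ∈ S → suc (∑∈ S f) ≤ # S * f v
  above v p = ≰⇒> λ q → none (v , p , q)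
  total : # S * ∑∈ S f < # S * ∑∈ S f
  total = begin-strict
    (# S) * ∑∈ S f              <⟨ *-monoʳ-< (# S) {{>-nonZero pos}} (n<1+n _) ⟩
    # S * suc (∑∈ S f)        ≡⟨ *-comm (# S) _ ⟩
    suc (∑∈ S f) * # S        ≡⟨ sym (∑∈-const S _) ⟩
    ∑∈ S (λ _ → suc (∑∈ S f))   ≤⟨ ∑∈-mono S above ⟩
    ∑∈ S (λ v → # S * f v)    ≡⟨ ∑∈-*ˡ S (# S) f ⟩
    # S * ∑∈ S f              ∎

-- Transitivity of x/b ≤ y/k ≤ z/a with denominators cleared. When the middle denominator is 0 the
-- chain says nothing, and `a` must vanish too.
≤-compose-ratios : ∀ a b k x y z → (k ≡ 0 → a ≡ 0) → k * x ≤ b * y → a * y ≤ k * z → a * x ≤ b * z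
≤-compose-ratios a b zero x y z p q r rewrite p refl = z≤n
≤-compose-ratios a b k@(suc _) x y z p q r = *-cancelˡ-≤ k (begin
  k * (a * x)   ≡⟨ *-exchange k a x ⟩
  a * (k * x)   ≤⟨ *-monoʳ-≤ a q ⟩
  a * (b * y)   ≡⟨ *-exchange a b y ⟩
  b * (a * y)   ≤⟨ *-monoʳ-≤ b r ⟩
  b * (k * z)   ≡⟨ *-exchange b k z ⟩
  k * (b * z)   ∎)
  where
  open ≤-Reasoning

-- Discarding elements of at most average weight, `r` times, never lowers the average. This takes
-- the place of averaging over all subsets of size `a`.
∃-heavy-subset : ∀ r a (T : Subset n) (f : Fin n → ℕ) → # T ≡ r + a →
  ∃[ T₀ ] (T₀ ⊆ T × # T₀ ≡ a × a * ∑∈ T f ≤ # T * ∑∈ T₀ f)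
∃-heavy-subset zero a T f eq = T , ⊆-refl , eq , ≤-reflexive (cong (_* ∑∈ T f) (sym eq))
∃-heavy-subset (suc r) a T f eq with ∃-below-average T f (subst (0 <_) (sym eq) z<s)
... | t , t∈T , low = T₀ , ⊆-trans T₀⊆ (split-⊆ʳ sp) , card₀ , bound
  where
  T′ = T ∖ ⁅ t ⁆
  sp : Split T ⁅ t ⁆ T′
  sp = ∖-split (⁅⁆⊆ t∈T)
  card : # T ≡ suc (# T′)
  card = trans (split-card sp) (cong (_+ (# T′)) (#-⁅⁆ t))
  card′ : # T′ ≡ r + a
  card′ = suc-injective (trans (sym card) eq)
  rec = ∃-heavy-subset r a T′ f card′
  T₀ = proj₁ rec
  T₀⊆ : T₀ ⊆ T′
  T₀⊆ = proj₁ (proj₂ rec)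
  card₀ = proj₁ (proj₂ (proj₂ rec))
  h = proj₂ (proj₂ (proj₂ rec))
  sumT : ∑∈ T f ≡ f t + ∑∈ T′ f
  sumT = trans (split-∑∈ sp f) (cong (_+ ∑∈ T′ f) (∑∈-⁅⁆ t f))
  open ≤-Reasoning
  -- Because t is at most average.
  one : # T′ * ∑∈ T f ≤ # T * ∑∈ T′ f
  one = +-cancelˡ-≤ (∑∈ T f) _ _ (begin
    suc (# T′) * ∑∈ T f          ≡⟨ cong₂ _*_ (sym card) sumT ⟩
    # T * (f t + ∑∈ T′ f)      ≡⟨ *-distribˡ-+ (# T) (f t) _ ⟩
    # T * f t + # T * ∑∈ T′ f ≤⟨ +-monoˡ-≤ _ low ⟩
    ∑∈ T f + # T * ∑∈ T′ f     ∎)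
  bound : a * ∑∈ T f ≤ # T * ∑∈ T₀ f
  bound = ≤-compose-ratios a (# T) (# T′) (∑∈ T f) (∑∈ T′ f) (∑∈ T₀ f) zero-case one h
    where
    zero-case : # T′ ≡ 0 → a ≡ 0
    zero-case z = m+n≡0⇒n≡0 r (trans (sym card′) z)

-- Hall's theorem, by the Halmos–Vaughan induction.  The hypothesis is kept in
-- the symmetric form "S × T contains an edge whenever |S| + |T| exceeds the
-- common size of the two sides", which passes to both parts of a critical split.

-- The entries of μ are 0 or 1, by the row sums.
record PerfectMatching (R : Fin n → Fin n → Bool) (A B : Subset n) : Set where
  field
    μ       : Fin n → Fin n → ℕ
    support : ∀ u v → 0 < μ u v → R u v ≡ true
    rows    : ∀ u → ∑ (μ u) ≡ χ A u
    cols    : ∀ v → ∑ (λ u → μ u v) ≡ χ B v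
open PerfectMatching

module _ {R : Fin n → Fin n → Bool} where

  matching-empty : ∀ {A B} → # A ≡ 0 → # B ≡ 0 → PerfectMatching R A B
  matching-empty {A} {B} a b = record
    { μ       = λ _ _ → 0
    ; support = λ _ _ ()
    ; rows    = λ u → trans (∑-zero {n} {λ _ → 0} λ _ → refl) (sym (vanish A a u))
    ; cols    = λ v → trans (∑-zero {n} {λ _ → 0} λ _ → refl) (sym (vanish B b v))
    }
    where
    vanish : ∀ C → # C ≡ 0 → ∀ u → χ C u ≡ 0
    vanish C c u = n≤0⇒n≡0 (subst (χ C u ≤_) c (f≤∑f (χ C) u))

  matching-edge : ∀ {u v} → R u v ≡ true → PerfectMatching R ⁅ u ⁆ ⁅ v ⁆
  matching-edge {u} {v} r = record
    { μ       = λ a b → χ ⁅ u ⁆ a * χ ⁅ v ⁆ b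
    ; support = supp
    ; rows    = λ a → trans (∑-*ˡ (χ ⁅ u ⁆ a) (χ ⁅ v ⁆)) (trans (cong (χ ⁅ u ⁆ a *_) (#-⁅⁆ v)) (*-identityʳ _))
    ; cols    = λ b → ∑∈-⁅⁆ u (λ _ → χ ⁅ v ⁆ b)
    }
    where
    supp : ∀ a b → 0 < χ ⁅ u ⁆ a * χ ⁅ v ⁆ b → R a b ≡ true
    supp a b p with χ ⁅ u ⁆ a in eqa | χ ⁅ v ⁆ b in eqb
    ... | suc _ | suc _
      rewrite x∈⁅y⁆⇒x≡y {x = a} u (0<χ⇒∈ (subst (0 <_) (sym eqa) z<s))
            | x∈⁅y⁆⇒x≡y {x = b} v (0<χ⇒∈ (subst (0 <_) (sym eqb) z<s)) = r
    ... | suc x | zero = contradiction (subst (0 <_) (*-zeroʳ x) p) λ ()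

  matching-glue : ∀ {A S X B Y T} → Split A S X → Split B Y T →
    PerfectMatching R S Y → PerfectMatching R X T → PerfectMatching R A B
  matching-glue spA spB m m′ = record
    { μ       = λ u v → μ m u v + μ m′ u v
    ; support = supp
    ; rows    = λ u → trans (∑-+ (μ m u) (μ m′ u))
                  (trans (cong₂ _+_ (rows m u) (rows m′ u)) (sym (χ-split spA u)))
    ; cols    = λ v → trans (∑-+ (λ u → μ m u v) (λ u → μ m′ u v))
                  (trans (cong₂ _+_ (cols m v) (cols m′ v)) (sym (χ-split spB v)))
    }
    where
    supp : ∀ u v → 0 < μ m u v + μ m′ u v → R u v ≡ true
    supp u v p with μ m u v in eq
    ... | suc _ = support m u v (subst (0 <_) (sym eq) z<s)
    ... | zero  = support m′ u v p

  EdgeBetween : Subset n → Subset n → Set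
  EdgeBetween S T = ∃₂ λ u v → u ∈ S × v ∈ T × R u v ≡ true

  edgeBetween? : ∀ S T → Dec (EdgeBetween S T)
  edgeBetween? S T = Fin.any? λ u → Fin.any? λ v →
    (u ∈? S) ×-dec (v ∈? T) ×-dec (R u v Bool.≟ true)

  Expanding : ℕ → Subset n → Subset n → Set
  Expanding s A B = ∀ S T → S ⊆ A → T ⊆ B → s < # S + # T → EdgeBetween S T

  -- All neighbours of `S` lie in the complement of `T` in `B`, which has exactly # S elements: `S`
  -- is a proper nonempty set for which Hall's condition is tight.
  Critical : ℕ → Subset n → Subset n → Subset n → Subset n → Set
  Critical s A B S T =
    S ⊆ A × T ⊆ B × 0 < # S × # S < s × # S + # T ≡ s × ¬ EdgeBetween S T

  critical? : ∀ s A B → Dec (∃₂ (Critical s A B))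
  critical? s A B = anySubset? λ S → anySubset? λ T →
    (S ⊆? A) ×-dec (T ⊆? B) ×-dec (0 <? # S) ×-dec (# S <? s)
      ×-dec (# S + # T ≟ s) ×-dec ¬? (edgeBetween? S T)

  -- The bound `k` drives the induction, since a critical split recurses on the sizes of both parts.
  -- There `S` is matched with the complement of `T`, and `T` with the complement of `S`.
  hall : ∀ k s {A B} → s ≤ k → # A ≡ s → # B ≡ s → Expanding s A B → PerfectMatching R A B
  hall k       zero         _          ca cb ex = matching-empty ca cb
  hall (suc k) s@(suc s′) {A} {B} (s≤s s′≤k) ca cb ex with critical? s A B
  ... | yes (S , T , S⊆A , T⊆B , 0<S , S<s , eq , none) =
    matching-glue spA (split-swap spB)
      (hall k (# S) (≤-trans (s≤s⁻¹ S<s) s′≤k) refl cY exY)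
      (hall k (# T) (≤-trans (s≤s⁻¹ T<s) s′≤k) cX refl exX)
    where
    X = A ∖ S
    Y = B ∖ T
    spA : Split A S X
    spA = ∖-split S⊆A
    spB : Split B T Y
    spB = ∖-split T⊆B
    T<s : # T < s
    T<s = subst (# T <_) eq (+-monoˡ-≤ (# T) 0<S)
    cX : # X ≡ # T
    cX = +-cancelˡ-≡ (# S) _ _ (trans (sym (split-card spA)) (trans ca (sym eq)))
    cY : # Y ≡ # S
    cY = +-cancelˡ-≡ (# T) _ _ (trans (sym (split-card spB)) (trans cb (trans (sym eq) (+-comm (# S) (# T)))))
    -- Adding all of `T` to `T′` makes the pair large enough for `ex`; the edge obtained cannot end
    -- in `T`, as nothing joins `S` to `T`. `exX` is the mirror image.
    exY : Expanding (# S) S Y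
    exY S′ T′ S′⊆S T′⊆Y big with ex S′ (T ∪ T′) (⊆-trans S′⊆S S⊆A) sub big′
      where
      dis : ∀ {i} → i ∈ T → i ∈ T′ → ⊥
      dis p q = split-disjoint spB p (T′⊆Y q)
      sp : Split (T ∪ T′) T T′
      sp = ∪-split dis
      sub : (T ∪ T′) ⊆ B
      sub p with split-cover sp p
      ... | inj₁ q = T⊆B q
      ... | inj₂ q = split-⊆ʳ spB (T′⊆Y q)
      open ≤-Reasoning
      big′ : s < # S′ + # (T ∪ T′)
      big′ = begin-strict
        s                             ≡⟨ sym eq ⟩
        # S + # T                 <⟨ +-monoˡ-< (# T) big ⟩
        # S′ + # T′ + # T       ≡⟨ +-assoc (# S′) (# T′) (# T) ⟩
        # S′ + (# T′ + # T)     ≡⟨ cong (# S′ +_) (trans (+-comm (# T′) (# T)) (sym (split-card sp))) ⟩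
        # S′ + # (T ∪ T′)           ∎
    ... | u , v , u∈ , v∈ , r with split-cover (∪-split {S = T} {T′} λ p q → split-disjoint spB p (T′⊆Y q)) v∈
    ...   | inj₁ v∈T = ⊥-elim (none (u , v , S′⊆S u∈ , v∈T , r))
    ...   | inj₂ v∈T′ = u , v , u∈ , v∈T′ , r
    exX : Expanding (# T) X T
    exX S′ T′ S′⊆X T′⊆T big with ex (S ∪ S′) T′ sub (⊆-trans T′⊆T T⊆B) big′
      where
      sp : Split (S ∪ S′) S S′
      sp = ∪-split λ p q → split-disjoint spA p (S′⊆X q)
      sub : (S ∪ S′) ⊆ A
      sub p with split-cover sp p
      ... | inj₁ q = S⊆A q
      ... | inj₂ q = split-⊆ʳ spA (S′⊆X q)
      open ≤-Reasoning
      big′ : s < # (S ∪ S′) + # T′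
      big′ = begin-strict
        s                             ≡⟨ sym eq ⟩
        # S + # T                 <⟨ +-monoʳ-< (# S) big ⟩
        # S + (# S′ + # T′)     ≡⟨ sym (+-assoc (# S) (# S′) (# T′)) ⟩
        # S + # S′ + # T′       ≡⟨ cong (_+ (# T′)) (sym (split-card sp)) ⟩
        # (S ∪ S′) + # T′           ∎
    ... | u , v , u∈ , v∈ , r with split-cover (∪-split {S = S} {S′} λ p q → split-disjoint spA p (S′⊆X q)) u∈
    ...   | inj₁ u∈S = ⊥-elim (none (u , v , u∈S , T′⊆T v∈ , r))
    ...   | inj₂ u∈S′ = u , v , u∈S′ , v∈ , r
  ... | no ¬critical with ex A B ⊆-refl ⊆-refl
        (subst₂ (λ a b → s < a + b) (sym ca) (sym cb) (m<m+n s z<s))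
  ...   | u , v , u∈A , v∈B , r =
    matching-glue spA spB (matching-edge r) (hall k s′ s′≤k cA′ cB′ ex′)
    where
    A′ = A ∖ ⁅ u ⁆
    B′ = B ∖ ⁅ v ⁆
    spA : Split A ⁅ u ⁆ A′
    spA = ∖-split (⁅⁆⊆ u∈A)
    spB : Split B ⁅ v ⁆ B′
    spB = ∖-split (⁅⁆⊆ v∈B)
    cA′ : # A′ ≡ s′
    cA′ = suc-injective (trans (cong (_+ (# A′)) (sym (#-⁅⁆ u))) (trans (sym (split-card spA)) ca))
    cB′ : # B′ ≡ s′
    cB′ = suc-injective (trans (cong (_+ (# B′)) (sym (#-⁅⁆ v))) (trans (sym (split-card spB)) cb))
    -- Beyond the reach of `ex` is only the case # S + # T = s. Without an edge that pair would be
    -- critical; `S` is nonempty because `T`, inside `B′`, has at most s′ elements.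
    ex′ : Expanding s′ A′ B′
    ex′ S T S⊆A′ T⊆B′ big with edgeBetween? S T
    ... | yes e = e
    ... | no none with m≤n⇒m<n∨m≡n big
    ...   | inj₁ lt = ex S T (⊆-trans S⊆A′ (split-⊆ʳ spA)) (⊆-trans T⊆B′ (split-⊆ʳ spB)) lt
    ...   | inj₂ eq = ⊥-elim (¬critical
              (S , T , ⊆-trans S⊆A′ (split-⊆ʳ spA) , ⊆-trans T⊆B′ (split-⊆ʳ spB)
                 , 0<S , s≤s (subst (# S ≤_) cA′ (#-mono S⊆A′)) , sym eq , none))
      where
      0<S : 0 < # S
      0<S = +-cancelʳ-< (# T) 0 (# S) (≤-trans (s≤s (subst (# T ≤_) cB′ (#-mono T⊆B′))) big)

-- Interval colourable pieces and their greedy removal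

sg : ℕ → ℕ
sg zero    = 0
sg (suc _) = 1

sg-pos : ∀ {k} → 0 < k → sg k ≡ 1
sg-pos {suc _} _ = refl

volume : Graph n → ℕ
volume G = ∑ λ u → ∑ λ v → ⟦ adj G u v ⟧

-- col u v is 0 when uv is not used and its colour otherwise; used edges are
-- directed, and no vertex has both incoming and outgoing ones.
record Piece (G : Graph n) : Set where
  field
    col      : Fin n → Fin n → ℕ
    edge     : ∀ u v → 0 < col u v → Edge G u v
    oriented : ∀ u v w → 0 < col u v → col w u ≡ 0
    out-inj  : ∀ u v v′ → 0 < col u v → col u v ≡ col u v′ → v ≡ v′
    out-int  : ∀ u a b x → 0 < col u a → col u a ≤ x → x ≤ col u b → ∃[ w ] col u w ≡ x
    in-inj   : ∀ v u u′ → 0 < col u v → col u v ≡ col u′ v → u ≡ u′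
    in-int   : ∀ v a b x → 0 < col a v → col a v ≤ x → x ≤ col b v → ∃[ w ] col w v ≡ x
  size : ℕ
  size = ∑ λ u → ∑ λ v → sg (col u v)

  colour : Fin n → Fin n → ℕ
  colour u v = col u v + col v u
open Piece

module _ {G : Graph n} (P : Piece G) where

  -- Each vertex is a source or a sink of the orientation, so the colours seen there form one row or
  -- one column of `col`. The separate conditions on rows and on columns therefore suffice for an
  -- interval colouring.
  Role : Fin n → Set
  Role v = (∀ w → colour P v w ≡ col P v w) ⊎ (∀ w → colour P v w ≡ col P w v)

  role : ∀ v w → 0 < colour P v w → Role v
  role v w p with col P v w in eq
  ... | suc _ = inj₁ λ x → trans (cong (col P v x +_) (oriented P v w x (subst (0 <_) (sym eq) z<s))) (+-identityʳ _)
  ... | zero  = inj₂ λ x → cong (_+ col P x v) (no-out x)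
    where
    no-out : ∀ x → col P v x ≡ 0
    no-out x with col P v x in eq′
    ... | zero  = refl
    ... | suc _ = contradiction (subst (0 <_) (oriented P v x w (subst (0 <_) (sym eq′) z<s)) p) λ ()

  piece-colourable : IntervalColourable (λ u v → 0 < colour P u v)
  piece-colourable = colour P , (λ u v _ → +-comm (col P u v) _) , proper , interval
    where
    proper : ∀ v w w′ → 0 < colour P v w → 0 < colour P v w′ → w ≢ w′ → colour P v w ≢ colour P v w′
    proper v w w′ p q ne eq with role v w p
    ... | inj₁ out = ne (out-inj P v w w′ (subst (0 <_) (out w) p) (trans (sym (out w)) (trans eq (out w′))))
    ... | inj₂ inn = ne (in-inj P v w w′ (subst (0 <_) (inn w) p) (trans (sym (inn w)) (trans eq (inn w′))))
    interval : ∀ v a b x → 0 < colour P v a → 0 < colour P v b → colour P v a ≤ x → x ≤ colour P v b →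
      ∃[ w ] (0 < colour P v w × colour P v w ≡ x)
    interval v a b x p q l r with role v a p
    ... | inj₁ out =
      let w , e = out-int P v a b x (subst (0 <_) (out a) p) (subst (_≤ x) (out a) l) (subst (x ≤_) (out b) r)
          e′ = trans (out w) e
      in w , subst (0 <_) (sym e′) (≤-trans p l) , e′
    ... | inj₂ inn =
      let w , e = in-int P v a b x (subst (0 <_) (inn a) p) (subst (_≤ x) (inn a) l) (subst (x ≤_) (inn b) r)
          e′ = trans (inn w) e
      in w , subst (0 <_) (sym e′) (≤-trans p l) , e′

  removePiece : Graph n
  removePiece = record
    { adj    = λ u v → adj G u v ∧ (colour P u v ≡ᵇ 0)
    ; sym    = λ u v → cong₂ (λ a c → a ∧ (c ≡ᵇ 0)) (Graph.sym G u v) (+-comm (col P u v) _)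
    ; irrefl = λ u → cong (_∧ (colour P u u ≡ᵇ 0)) (irrefl G u)
    }

  -- Volume counts ordered pairs and so loses two per removed edge. Charging only the oriented copy
  -- keeps the inequality pointwise and wastes a constant factor.
  removePiece-volume : volume removePiece + size P ≤ volume G
  removePiece-volume = begin
    volume removePiece + size P
      ≡⟨ sym (∑-+ (λ u → ∑ λ v → ⟦ adj removePiece u v ⟧) (λ u → ∑ λ v → sg (col P u v))) ⟩
    ∑ (λ u → ∑ (λ v → ⟦ adj removePiece u v ⟧) + ∑ (λ v → sg (col P u v)))
      ≡⟨ ∑-cong (λ u → sym (∑-+ (λ v → ⟦ adj removePiece u v ⟧) (λ v → sg (col P u v)))) ⟩
    ∑ (λ u → ∑ (λ v → ⟦ adj removePiece u v ⟧ + sg (col P u v)))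
      ≤⟨ ∑-mono (λ u → ∑-mono (λ v → pointwise u v)) ⟩
    volume G ∎
    where
    open ≤-Reasoning
    pointwise : ∀ u v → ⟦ adj removePiece u v ⟧ + sg (col P u v) ≤ ⟦ adj G u v ⟧
    pointwise u v with col P u v in eq
    ... | suc _ rewrite edge P u v (subst (0 <_) (sym eq) z<s) = ≤-refl
    ... | zero with adj G u v | col P v u
    ...   | false | _     = z≤n
    ...   | true  | zero  = ≤-refl
    ...   | true  | suc _ = z≤n

  edge-colour : ∀ u v → 0 < colour P u v → Edge G u v
  edge-colour u v p with col P u v in eq
  ... | suc _ = edge P u v (subst (0 <_) (sym eq) z<s)
  ... | zero  = trans (Graph.sym G u v) (edge P v u p)

interval-resp : {E F : Fin n → Fin n → Set} → (∀ u v → E u v → F u v) → (∀ u v → F u v → E u v) →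
  IntervalColourable E → IntervalColourable F
interval-resp to from (c , sy , proper , interval) =
  c , (λ u v f → sy u v (from u v f))
    , (λ v w w′ f f′ → proper v w w′ (from v w f) (from v w′ f′))
    , λ v a b x f f′ l r → let w , e , eq = interval v a b x (from v a f) (from v b f′) l r in w , to v w e , eq

-- Classes are bounded naturals rather than elements of `Fin t`: a further class needs no
-- renumbering, and t = 0 makes sense for an edgeless graph.
Thick : Graph n → ℕ → Set
Thick {n} G t = Σ (Fin n → Fin n → ℕ) λ p →
  (∀ u v → Edge G u v → p u v ≡ p v u)
  × (∀ u v → Edge G u v → p u v < t)
  × (∀ i → IntervalColourable (λ u v → Edge G u v × p u v ≡ i))

thick-mono : {G : Graph n} → ∀ {s t} → s ≤ t → Thick G s → Thick G t
thick-mono s≤t (p , sy , bd , ic) = p , sy , (λ u v e → ≤-trans (bd u v e) s≤t) , ic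

thick-empty : {G : Graph n} → ∀ {t} → volume G ≡ 0 → Thick G t
thick-empty {G = G} vol = (λ _ _ → 0) , (λ _ _ _ → refl) , (λ u v e → ⊥-elim (none u v e))
  , λ i → (λ _ _ → 0) , (λ _ _ _ → refl) , (λ v w _ e _ _ _ → none v w (proj₁ e))
        , λ v a _ _ e _ _ _ → ⊥-elim (none v a (proj₁ e))
  where
  none : ∀ u v → Edge G u v → ⊥
  none u v e = contradiction (≤-trans (≤-trans (≤-reflexive (sym (⟦true⟧ e))) (f≤∑f (λ v → ⟦ adj G u v ⟧) v))
    (≤-trans (f≤∑f (λ u → ∑ λ v → ⟦ adj G u v ⟧) u) (≤-reflexive vol))) λ ()

thick-removePiece : {G : Graph n} (P : Piece G) → ∀ {t} → Thick (removePiece P) t → Thick G (suc t)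
thick-removePiece {n = n} {G} P {t} (p , sy , bd , ic) = p′ , sy′ , bd′ , ic′
  where
  G′ = removePiece P
  p′ : Fin n → Fin n → ℕ
  p′ u v = if colour P u v ≡ᵇ 0 then p u v else t
  data Case (u v : Fin n) : Set where
    kept    : Edge G′ u v → p′ u v ≡ p u v → Case u v
    removed : 0 < colour P u v → p′ u v ≡ t → Case u v
  case : ∀ u v → Edge G u v → Case u v
  case u v e with colour P u v ≡ᵇ 0 in eq
  ... | true  = kept (cong₂ _∧_ e eq) (cong (if_then p u v else t) eq)
  ... | false = removed (n≢0⇒n>0 λ z → contradiction (trans (sym eq) (cong (_≡ᵇ 0) z)) λ ())
                        (cong (if_then p u v else t) eq)
  kept-edge : ∀ u v → Edge G′ u v → Edge G u v × p′ u v ≡ p u v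
  kept-edge u v e with adj G u v | colour P u v ≡ᵇ 0
  ... | true | true = refl , refl
  removed-class : ∀ u v → 0 < colour P u v → p′ u v ≡ t
  removed-class u v q with colour P u v
  ... | suc _ = refl
  sy′ : ∀ u v → Edge G u v → p′ u v ≡ p′ v u
  sy′ u v e with case u v e
  ... | kept e′ eq = trans eq (trans (sy u v e′) (sym (proj₂ (kept-edge v u (trans (Graph.sym G′ v u) e′)))))
  ... | removed q eq = trans eq (sym (removed-class v u (subst (0 <_) (+-comm (col P u v) _) q)))
  bd′ : ∀ u v → Edge G u v → p′ u v < suc t
  bd′ u v e with case u v e
  ... | kept e′ eq   = subst (_< suc t) (sym eq) (m<n⇒m<1+n (bd u v e′))
  ... | removed q eq = subst (_< suc t) (sym eq) ≤-refl
  ic′ : ∀ i → IntervalColourable (λ u v → Edge G u v × p′ u v ≡ i)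
  ic′ i with i ≟ t
  ... | yes refl = interval-resp (λ u v q → edge-colour P u v q , removed-class u v q) back (piece-colourable P)
    where
    back : ∀ u v → Edge G u v × p′ u v ≡ t → 0 < colour P u v
    back u v (e , eq) with case u v e
    ... | removed q _  = q
    ... | kept e′ eq′ = contradiction (trans (sym eq′) eq) (<⇒≢ (bd u v e′))
  ... | no i≢t = interval-resp forth back (ic i)
    where
    forth : ∀ u v → Edge G′ u v × p u v ≡ i → Edge G u v × p′ u v ≡ i
    forth u v (e , eq) = let e′ , q = kept-edge u v e in e′ , trans q eq
    back : ∀ u v → Edge G u v × p′ u v ≡ i → Edge G′ u v × p u v ≡ i
    back u v (e , eq) with case u v e
    ... | kept e′ eq′   = e′ , trans (sym eq′) eq
    ... | removed _ eq′ = contradiction (trans (sym eq) eq′) i≢t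

thick⇒thickness : {G : Graph n} → ∀ {t} → Thick G (suc t) → ThicknessAtMost G (suc t)
thick⇒thickness {G = G} {t} (p , sy , bd , ic) = (λ u v → clamp (p u v)) , (λ u v e → cong clamp (sy u v e)) ,
  λ i → interval-resp (λ u v (e , eq) → e , forth u v i e eq) (λ u v (e , eq) → e , back u v i e eq) (ic (Fin.toℕ i))
  where
  -- Off the edges `p` is unrestricted, so values are cut off at `t`; on edges this changes nothing.
  clamp : ℕ → Fin (suc t)
  clamp k = Fin.fromℕ< {k ⊓ t} (s≤s (m⊓n≤n k t))
  toℕ-clamp : ∀ u v → Edge G u v → Fin.toℕ (clamp (p u v)) ≡ p u v
  toℕ-clamp u v e = trans (Fin.toℕ-fromℕ< _) (m≤n⇒m⊓n≡m (s≤s⁻¹ (bd u v e)))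
  forth : ∀ u v i → Edge G u v → p u v ≡ Fin.toℕ i → clamp (p u v) ≡ i
  forth u v i e eq = Fin.toℕ-injective (trans (toℕ-clamp u v e) eq)
  back : ∀ u v i → Edge G u v → clamp (p u v) ≡ i → p u v ≡ Fin.toℕ i
  back u v i e eq = trans (sym (toℕ-clamp u v e)) (cong Fin.toℕ eq)

-- While volume G ≥ 2^j every step removes at least 2^j / q of it.
module _ (Good : Graph n → Set) (q : ℕ)
  (step : ∀ G → Good G → 0 < volume G → Σ (Piece G) λ P → volume G ≤ q * size P × Good (removePiece P)) where

  -- The hypothesis on `G` is a budget with `i` removals left. A removal at volume at least 2^j
  -- lowers q · volume by at least 2^j, so once i = 0 the volume is below 2^j.
  thick-phase : ∀ j t → (∀ G → Good G → volume G < 2 ^ j → Thick G t) →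
    ∀ i G → Good G → q * volume G < q * 2 ^ j + i * 2 ^ j → Thick G (i + t)
  thick-phase j t base zero G good lt =
    base G good (*-cancelˡ-< q _ _ (subst (q * volume G <_) (+-identityʳ _) lt))
  thick-phase j t base (suc i) G good lt with volume G <? 2 ^ j
  ... | yes small = thick-mono {G = G} (m≤n+m t (suc i)) (base G good small)
  ... | no ¬small = thick-removePiece P (thick-phase j t base i (removePiece P) good′ lt′)
    where
    large : 2 ^ j ≤ volume G
    large = ≮⇒≥ ¬small
    st = step G good (≤-trans (m^n>0 2 j) large)
    P = proj₁ st
    good′ = proj₂ (proj₂ st)
    open ≤-Reasoning
    lt′ : q * volume (removePiece P) < q * 2 ^ j + i * 2 ^ j
    lt′ = +-cancelʳ-< (2 ^ j) _ _ (begin-strict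
      q * volume (removePiece P) + 2 ^ j
        ≤⟨ +-monoʳ-≤ _ (≤-trans large (proj₁ (proj₂ st))) ⟩
      q * volume (removePiece P) + q * size P
        ≡⟨ sym (*-distribˡ-+ q (volume (removePiece P)) (size P)) ⟩
      q * (volume (removePiece P) + size P)
        ≤⟨ *-monoʳ-≤ q (removePiece-volume P) ⟩
      q * volume G
        <⟨ lt ⟩
      q * 2 ^ j + (2 ^ j + i * 2 ^ j)
        ≡⟨ cong (q * 2 ^ j +_) (+-comm (2 ^ j) _) ⟩
      q * 2 ^ j + (i * 2 ^ j + 2 ^ j)
        ≡⟨ sym (+-assoc (q * 2 ^ j) _ _) ⟩
      q * 2 ^ j + i * 2 ^ j + 2 ^ j ∎)

  -- Halving the bound on the volume costs at most `q` pieces, and `j` halvings leave no edge.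
  thick-log : 0 < q → ∀ j G → Good G → volume G < 2 ^ j → Thick G (j * q)
  thick-log 0<q zero    G good lt = thick-empty {G = G} (n<1⇒n≡0 lt)
  thick-log 0<q (suc j) G good lt = thick-phase j (j * q) (thick-log 0<q j) q G good (begin-strict
    q * volume G            <⟨ *-monoʳ-< q {{>-nonZero 0<q}} lt ⟩
    q * (2 ^ j + (2 ^ j + 0)) ≡⟨ cong (λ x → q * (2 ^ j + x)) (+-identityʳ _) ⟩
    q * (2 ^ j + 2 ^ j)     ≡⟨ *-distribˡ-+ q (2 ^ j) _ ⟩
    q * 2 ^ j + q * 2 ^ j   ∎)
    where open ≤-Reasoning

-- Cuts

between : (Fin n → Fin n → ℕ) → Subset n → Subset n → ℕ
between w S T = ∑∈ S λ u → ∑∈ T (w u)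

Disjoint : Subset n → Subset n → Set
Disjoint A B = ∀ {i} → i ∈ A → i ∈ B → ⊥

xor-flip : ∀ b c x → ⟦ b xor c ⟧ * x + ⟦ not b xor c ⟧ * x ≡ x
xor-flip false false x = +-identityʳ x
xor-flip false true  x = trans (+-identityʳ _) (+-identityʳ x)
xor-flip true  false x = trans (+-identityʳ _) (+-identityʳ x)
xor-flip true  true  x = +-identityʳ x

∃-half : ∀ (f : Bool → ℕ) x → f true + f false ≡ x → ∃[ b ] x ≤ 2 * f b
∃-half f x refl with ≤-total (f true) (f false)
... | inj₁ p = false , ≤-trans (+-monoˡ-≤ _ p) (≤-reflexive (cong (f false +_) (sym (+-identityʳ _))))
... | inj₂ p = true  , ≤-trans (+-monoʳ-≤ _ p) (≤-reflexive (cong (f true +_) (sym (+-identityʳ _))))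

-- Given a cut of the other vertices, vertex `zero` has two possible sides, and each pair containing
-- it is cut by exactly one of them (`xor-flip`). The better side cuts at least half of the weight
-- at `zero`.
max-cut : ∀ {n} (w : Fin n → Fin n → ℕ) → (∀ u → w u u ≡ 0) →
  Σ (Fin n → Bool) λ h → ∑ (λ u → ∑ (w u)) ≤ 2 * ∑ (λ u → ∑ λ v → ⟦ h u xor h v ⟧ * w u v)
max-cut {zero}  w loop = (λ ()) , z≤n
max-cut {suc n} w loop = h , bound
  where
  w′ : Fin n → Fin n → ℕ
  w′ u v = w (suc u) (suc v)
  rec = max-cut w′ (loop ∘ suc)
  h′ = proj₁ rec
  out inn star : Fin n → ℕ
  out v = w zero (suc v)
  inn v = w (suc v) zero
  star v = out v + inn v
  half = ∃-half (λ b → ∑ λ v → ⟦ b xor h′ v ⟧ * star v) (∑ star)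
    (trans (sym (∑-+ (λ v → ⟦ true xor h′ v ⟧ * star v) (λ v → ⟦ false xor h′ v ⟧ * star v)))
           (∑-cong λ v → xor-flip true (h′ v) (star v)))
  b = proj₁ half
  h : Fin (suc n) → Bool
  h zero    = b
  h (suc v) = h′ v
  cut′ = ∑ (λ u → ∑ λ v → ⟦ h′ u xor h′ v ⟧ * w′ u v)
  expand : (x : Fin (suc n) → Fin (suc n) → ℕ) → x zero zero ≡ 0 →
    ∑ (λ u → ∑ (x u)) ≡ ∑ (λ v → x zero (suc v) + x (suc v) zero) + ∑ (λ u → ∑ (λ v → x (suc u) (suc v)))
  expand x z = begin
    x zero zero + ∑ (λ v → x zero (suc v)) + ∑ (λ u → x (suc u) zero + ∑ (λ v → x (suc u) (suc v)))
      ≡⟨ cong₂ (λ a c → a + ∑ (λ v → x zero (suc v)) + c) z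
           (∑-+ (λ u → x (suc u) zero) (λ u → ∑ (λ v → x (suc u) (suc v)))) ⟩
    ∑ (λ v → x zero (suc v)) + (∑ (λ u → x (suc u) zero) + ∑ (λ u → ∑ (λ v → x (suc u) (suc v))))
      ≡⟨ sym (+-assoc (∑ (λ v → x zero (suc v))) _ _) ⟩
    ∑ (λ v → x zero (suc v)) + ∑ (λ u → x (suc u) zero) + ∑ (λ u → ∑ (λ v → x (suc u) (suc v)))
      ≡⟨ cong (_+ ∑ (λ u → ∑ (λ v → x (suc u) (suc v))))
           (sym (∑-+ (λ v → x zero (suc v)) (λ u → x (suc u) zero))) ⟩
    ∑ (λ v → x zero (suc v) + x (suc v) zero) + ∑ (λ u → ∑ (λ v → x (suc u) (suc v))) ∎
    where open ≡-Reasoning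
  xor-comm : ∀ a c → a xor c ≡ c xor a
  xor-comm false false = refl
  xor-comm false true  = refl
  xor-comm true  false = refl
  xor-comm true  true  = refl
  cut : Fin (suc n) → Fin (suc n) → ℕ
  cut u v = ⟦ h u xor h v ⟧ * w u v
  merge : ∀ v → ⟦ b xor h′ v ⟧ * star v ≡ cut zero (suc v) + cut (suc v) zero
  merge v = trans (*-distribˡ-+ ⟦ b xor h′ v ⟧ (out v) (inn v))
    (cong (λ c → ⟦ b xor h′ v ⟧ * out v + ⟦ c ⟧ * inn v) (xor-comm b (h′ v)))
  open ≤-Reasoning
  bound : ∑ (λ u → ∑ (w u)) ≤ 2 * ∑ (λ u → ∑ (cut u))
  bound = begin
    ∑ (λ u → ∑ (w u))
      ≡⟨ expand w (loop zero) ⟩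
    ∑ star + ∑ (λ u → ∑ (w′ u))
      ≤⟨ +-mono-≤ (proj₂ half) (proj₂ rec) ⟩
    2 * ∑ (λ v → ⟦ b xor h′ v ⟧ * star v) + 2 * cut′
      ≡⟨ sym (*-distribˡ-+ 2 (∑ (λ v → ⟦ b xor h′ v ⟧ * star v)) cut′) ⟩
    2 * (∑ (λ v → ⟦ b xor h′ v ⟧ * star v) + cut′)
      ≡⟨ cong (λ c → 2 * (c + cut′)) (∑-cong merge) ⟩
    2 * (∑ (λ v → cut zero (suc v) + cut (suc v) zero) + cut′)
      ≡⟨ cong (2 *_) (sym (expand cut (trans (cong (⟦ b xor b ⟧ *_) (loop zero)) (*-zeroʳ ⟦ b xor b ⟧)))) ⟩
    2 * ∑ (λ u → ∑ (cut u)) ∎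

-- The weight need not be symmetric. A cut keeps half of the total and its heavier direction half of
-- that, hence the 4. Both sides are kept inside `V` so that their sizes are bounded by # V.
directed-cut : (w : Fin n → Fin n → ℕ) → (∀ u → w u u ≡ 0) →
  (V : Subset n) → (∀ u v → 0 < w u v → u ∈ V × v ∈ V) →
  ∃₂ λ A B → A ⊆ V × B ⊆ V × Disjoint A B × ∑ (λ u → ∑ (w u)) ≤ 4 * between w A B
directed-cut {n} w loop V inV = result
  where
  mc = max-cut w loop
  h = proj₁ mc
  side : Bool → Subset n
  side b = tabulate λ u → (b xor not (h u)) ∧ lookup V u
  side-lookup : ∀ b u → lookup (side b) u ≡ (b xor not (h u)) ∧ lookup V u
  side-lookup b u = lookup∘tabulate (λ u → (b xor not (h u)) ∧ lookup V u) u
  side⊆ : ∀ b → side b ⊆ V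
  side⊆ b {u} p = lookup⇒[]= u V (aux (trans (sym (side-lookup b u)) ([]=⇒lookup p)))
    where
    aux : ∀ {c d} → c ∧ d ≡ true → d ≡ true
    aux {true} q = q
  side-xor : ∀ b {u} → u ∈ side b → b xor not (h u) ≡ true
  side-xor b {u} p = aux (trans (sym (side-lookup b u)) ([]=⇒lookup p))
    where
    aux : ∀ {c d} → c ∧ d ≡ true → c ≡ true
    aux {true} q = refl
  side-disjoint : ∀ b → Disjoint (side b) (side (not b))
  side-disjoint b {u} p q = aux b (h u) (side-xor b p) (side-xor (not b) q)
    where
    aux : ∀ b c → b xor not c ≡ true → not b xor not c ≡ true → ⊥
    aux true  true  _ ()
    aux true  false ()
    aux false true  ()
    aux false false _ ()
  val : Bool → ℕ
  val b = between w (side b) (side (not b))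
  pointwise : ∀ u v → ⟦ h u xor h v ⟧ * w u v ≤
    χ (side true) u * (χ (side false) v * w u v) + χ (side false) u * (χ (side true) v * w u v)
  pointwise u v with w u v in eq
  ... | zero = ≤-trans (≤-reflexive (*-zeroʳ ⟦ h u xor h v ⟧)) z≤n
  ... | suc k rewrite side-lookup true u | side-lookup false u | side-lookup true v | side-lookup false v
                    | []=⇒lookup (proj₁ (inV u v (subst (0 <_) (sym eq) z<s)))
                    | []=⇒lookup (proj₂ (inV u v (subst (0 <_) (sym eq) z<s))) with h u | h v
  ...   | true  | true  = z≤n
  ...   | true  | false = ≤-trans (≤-reflexive (sym (+-identityʳ _))) (m≤m+n _ _)
  ...   | false | true  = ≤-reflexive (sym (+-identityʳ _))
  ...   | false | false = z≤n
  open ≤-Reasoning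
  between-expand : ∀ S T → between w S T ≡ ∑ (λ u → ∑ λ v → χ S u * (χ T v * w u v))
  between-expand S T = ∑-cong λ u → sym (∑-*ˡ (χ S u) (λ v → χ T v * w u v))
  both : ∑ (λ u → ∑ λ v → ⟦ h u xor h v ⟧ * w u v) ≤ val true + val false
  both = begin
    ∑ (λ u → ∑ λ v → ⟦ h u xor h v ⟧ * w u v)
      ≤⟨ ∑-mono (λ u → ∑-mono (pointwise u)) ⟩
    ∑ (λ u → ∑ λ v → x true u v + x false u v)
      ≡⟨ ∑-cong (λ u → ∑-+ (x true u) (x false u)) ⟩
    ∑ (λ u → ∑ (x true u) + ∑ (x false u))
      ≡⟨ ∑-+ (λ u → ∑ (x true u)) (λ u → ∑ (x false u)) ⟩
    ∑ (λ u → ∑ (x true u)) + ∑ (λ u → ∑ (x false u))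
      ≡⟨ sym (cong₂ _+_ (between-expand (side true) (side false)) (between-expand (side false) (side true))) ⟩
    val true + val false ∎
    where
    x : Bool → Fin n → Fin n → ℕ
    x b u v = χ (side b) u * (χ (side (not b)) v * w u v)
  half = ∃-half val _ refl
  result : ∃₂ λ A B → A ⊆ V × B ⊆ V × Disjoint A B × ∑ (λ u → ∑ (w u)) ≤ 4 * between w A B
  result with half
  ... | b , q = side b , side (not b) , side⊆ b , side⊆ (not b) , side-disjoint b , (begin
    ∑ (λ u → ∑ (w u))            ≤⟨ proj₂ mc ⟩
    2 * ∑ (λ u → ∑ λ v → ⟦ h u xor h v ⟧ * w u v) ≤⟨ *-monoʳ-≤ 2 (≤-trans both q) ⟩
    2 * (2 * val b)              ≡⟨ sym (*-assoc 2 2 (val b)) ⟩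
    4 * val b                    ∎)

-- Star forests

-- Numbers the leaves of a star 0, 1, 2, ... in index order, which supplies consecutive colours.
rank : (Fin n → Bool) → Fin n → ℕ
rank P zero    = 0
rank P (suc i) = ⟦ P zero ⟧ + rank (P ∘ suc) i

rank-injective : (P : Fin n → Bool) → ∀ i j → P i ≡ true → P j ≡ true → rank P i ≡ rank P j → i ≡ j
rank-injective P zero    zero    p q eq = refl
rank-injective P zero    (suc j) p q eq rewrite p = contradiction eq λ ()
rank-injective P (suc i) zero    p q eq rewrite q = contradiction eq λ ()
rank-injective P (suc i) (suc j) p q eq =
  cong suc (rank-injective (P ∘ suc) i j p q (+-cancelˡ-≡ ⟦ P zero ⟧ _ _ eq))

rank-interval : (P : Fin n → Bool) → ∀ i x → P i ≡ true → x ≤ rank P i → ∃[ j ] (P j ≡ true × rank P j ≡ x)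
rank-interval P zero    .0 p z≤n = zero , p , refl
rank-interval P (suc i) x p le with P zero in eq
rank-interval P (suc i) zero    p le | true = zero , eq , refl
rank-interval P (suc i) (suc x) p le | true =
  let j , q , r = rank-interval (P ∘ suc) i x p (s≤s⁻¹ le)
  in suc j , q , trans (cong (λ b → ⟦ b ⟧ + rank (P ∘ suc) j) eq) (cong suc r)
rank-interval P (suc i) x p le | false =
  let j , q , r = rank-interval (P ∘ suc) i x p le
  in suc j , q , trans (cong (λ b → ⟦ b ⟧ + rank (P ∘ suc) j) eq) r

module _ (G : Graph n) where

  neighbour? : ∀ u → Dec (∃[ v ] Edge G u v)
  neighbour? u = Fin.any? λ v → adj G u v Bool.≟ true

  -- Only these vertices are counted by N. With isolated ones included, N = O(f) would fail, and the
  -- bound in terms of edges could not be independent of `n`.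
  nonIsolated : Subset n
  nonIsolated = tabulate λ u → ⌊ neighbour? u ⌋

  edge⇒nonIsolated : ∀ u v → Edge G u v → u ∈ nonIsolated
  edge⇒nonIsolated u v e = lookup⇒[]= u nonIsolated (trans (lookup∘tabulate _ u) aux)
    where
    aux : ⌊ neighbour? u ⌋ ≡ true
    aux with neighbour? u
    ... | yes _ = refl
    ... | no ¬p = contradiction (v , e) ¬p

  neighbour : Fin n → Fin n
  neighbour u with neighbour? u
  ... | yes (v , _) = v
  ... | no _        = u

  neighbour-edge : ∀ {u} → u ∈ nonIsolated → Edge G u (neighbour u)
  neighbour-edge {u} p with trans (sym (lookup∘tabulate (λ u → ⌊ neighbour? u ⌋) u)) ([]=⇒lookup p)
  ... | q with neighbour? u
  ...   | yes (v , e) = e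

  -- Every non-isolated vertex points to one chosen neighbour, so the total weight is N. The
  -- pointers from `A` to a disjoint `B` form stars with centres in `B`, since each vertex of `A`
  -- has at most one.
  pointer : Fin n → Fin n → ℕ
  pointer u v = χ nonIsolated u * χ ⁅ neighbour u ⁆ v

  pointer-pos : ∀ {u v} → 0 < pointer u v → u ∈ nonIsolated × v ≡ neighbour u
  pointer-pos {u} {v} p with χ nonIsolated u in eq | χ ⁅ neighbour u ⁆ v in eq′
  ... | suc _ | suc _ = 0<χ⇒∈ (subst (0 <_) (sym eq) z<s) , x∈⁅y⁆⇒x≡y (neighbour u) (0<χ⇒∈ (subst (0 <_) (sym eq′) z<s))
  ... | suc x | zero = contradiction (subst (0 <_) (*-zeroʳ x) p) λ ()

  pointer-edge : ∀ {u v} → 0 < pointer u v → Edge G u v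
  pointer-edge p with pointer-pos p
  ... | q , refl = neighbour-edge q

  pointer-total : ∑ (λ u → ∑ (pointer u)) ≡ # nonIsolated
  pointer-total = ∑-cong λ u → trans (∑-*ˡ (χ nonIsolated u) (χ ⁅ neighbour u ⁆))
    (trans (cong (χ nonIsolated u *_) (#-⁅⁆ (neighbour u))) (*-identityʳ _))

  module _ (A B : Subset n) (disjoint : Disjoint A B) where

    leafOf : Fin n → Fin n → Bool
    leafOf v u = lookup A u ∧ (lookup B v ∧ (0 <ᵇ pointer u v))

    record Leaf (v u : Fin n) : Set where
      constructor leaf
      field
        inA : u ∈ A
        inB : v ∈ B
        pos : 0 < pointer u v

    to-leaf : ∀ {v u} → leafOf v u ≡ true → Leaf v u
    to-leaf {v} {u} eq with lookup A u in a | lookup B v in b | pointer u v in c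
    ... | true | true | suc _ = leaf (lookup⇒[]= u A a) (lookup⇒[]= v B b) (subst (0 <_) (sym c) z<s)

    star : Fin n → Fin n → ℕ
    star u v = if leafOf v u then suc (rank (leafOf v) u) else 0

    star-leaf : ∀ {u v} → leafOf v u ≡ true → star u v ≡ suc (rank (leafOf v) u)
    star-leaf {u} {v} eq = cong (if_then suc (rank (leafOf v) u) else 0) eq

    star-pos : ∀ {u v} → 0 < star u v → leafOf v u ≡ true
    star-pos {u} {v} = aux (leafOf v u)
      where
      aux : ∀ b {k} → 0 < (if b then k else 0) → b ≡ true
      aux true _ = refl

    star⇒leaf : ∀ u v → 0 < star u v → Leaf v u
    star⇒leaf u v p = to-leaf (star-pos {u} {v} p)

    centre : ∀ u v → 0 < star u v → v ≡ neighbour u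
    centre u v p = proj₂ (pointer-pos (Leaf.pos (star⇒leaf u v p)))

    star-oriented : ∀ u v w → 0 < star u v → star w u ≡ 0
    star-oriented u v w p with star w u in eq
    ... | zero  = refl
    ... | suc _ = ⊥-elim (disjoint (Leaf.inA (star⇒leaf u v p))
                                   (Leaf.inB (star⇒leaf w u (subst (0 <_) (sym eq) z<s))))

    star-in-inj : ∀ v u u′ → 0 < star u v → star u v ≡ star u′ v → u ≡ u′
    star-in-inj v u u′ p eq = rank-injective (leafOf v) u u′ q q′
      (suc-injective (trans (sym (star-leaf {u} {v} q)) (trans eq (star-leaf {u′} {v} q′))))
      where
      q  = star-pos {u} {v} p
      q′ = star-pos {u′} {v} (subst (0 <_) eq p)

    star-in-int : ∀ v a b x → 0 < star a v → star a v ≤ x → x ≤ star b v → ∃[ w ] star w v ≡ x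
    star-in-int v a b zero    p l r = contradiction (≤-trans p l) λ ()
    star-in-int v a b (suc x) p l r =
      let q = star-pos {b} {v} (≤-trans p (≤-trans l r))
          j , s , t = rank-interval (leafOf v) b x q (s≤s⁻¹ (subst (suc x ≤_) (star-leaf {b} {v} q) r))
      in j , trans (star-leaf {j} {v} s) (cong suc t)

    stars : Piece G
    stars = record
      { col      = star
      ; edge     = λ u v p → pointer-edge (Leaf.pos (star⇒leaf u v p))
      ; oriented = star-oriented
      -- A leaf has only the edge to its centre, so its colour set is a single number.
      ; out-inj  = λ u v v′ p eq → trans (centre u v p) (sym (centre u v′ (subst (0 <_) eq p)))
      ; out-int  = λ u a b x p l r → a , ≤-antisym l (subst (λ c → x ≤ star u c)
                     (trans (centre u b (≤-trans p (≤-trans l r))) (sym (centre u a p))) r)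
      ; in-inj   = star-in-inj
      ; in-int   = star-in-int
      }

    pointer≤stars : ∀ u v → χ A u * (χ B v * pointer u v) ≤ sg (star u v)
    pointer≤stars u v = aux (lookup A u) (lookup B v) (*-mono-≤ (χ≤1 nonIsolated u) (χ≤1 ⁅ neighbour u ⁆ v))
      where
      aux : ∀ a b {p k} → p ≤ 1 → ⟦ a ⟧ * (⟦ b ⟧ * p) ≤ sg (if a ∧ (b ∧ (0 <ᵇ p)) then suc k else 0)
      aux false _     _ = z≤n
      aux true  false _ = z≤n
      aux true  true {zero}     _ = z≤n
      aux true  true {suc zero} _ = ≤-refl
      aux true  true {suc (suc _)} (s≤s ())

    between-pointer : between pointer A B ≤ size stars
    between-pointer = ∑-mono λ u →
      ≤-trans (≤-reflexive (sym (∑-*ˡ (χ A u) (λ v → χ B v * pointer u v)))) (∑-mono (pointer≤stars u))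

  star-forest : Σ (Piece G) λ P → # nonIsolated ≤ 4 * size P
  star-forest =
    let A , B , _ , _ , disjoint , bound = directed-cut pointer loop nonIsolated ends
    in stars A B disjoint ,
       ≤-trans (≤-reflexive (sym pointer-total)) (≤-trans bound (*-monoʳ-≤ 4 (between-pointer A B disjoint)))
    where
    loop : ∀ u → pointer u u ≡ 0
    loop u with pointer u u in eq
    ... | zero  = refl
    ... | suc _ = contradiction (trans (sym (irrefl G u)) (pointer-edge (subst (0 <_) (sym eq) z<s))) λ ()
    ends : ∀ u v → 0 < pointer u v → u ∈ nonIsolated × v ∈ nonIsolated
    ends u v p = proj₁ (pointer-pos p) , edge⇒nonIsolated v u (trans (Graph.sym G v u) (pointer-edge p))

-- Numerical inequalities behind degrees and expansion

^-cancelʳ-≤ : ∀ k .{{_ : NonZero k}} {x y} → x ^ k ≤ y ^ k → x ≤ y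
^-cancelʳ-≤ k {x} {y} p with x ≤? y
... | yes q = q
... | no q  = contradiction p (<⇒≱ (^-monoˡ-< k (≰⇒> q)))

^-pos : ∀ {x} k → 0 < x → 0 < x ^ k
^-pos {x} k p = m^n>0 x {{>-nonZero p}} k

-- With s = 1 + p and q = 20 s - 33 this is (1 - 33/(20 s))³ > (1 - 1/s)⁵.
quintic : ∀ p t q → q + 13 ≡ 20 * p → 2 * q ≡ 39 * p + t → p ≤ 2 * t → 1020 ≤ q →
  (20 * p) ^ 3 * p ^ 2 < q ^ 3 * (1 + p) ^ 2
quintic p t q eq₁ eq₂ p≤2t big = *-cancelˡ-< 2 _ _ (begin-strict
  2 * ((20 * p) ^ 3 * p ^ 2)
    ≡⟨ cong (λ x → 2 * (x ^ 3 * p ^ 2)) (sym eq₁) ⟩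
  2 * ((q + 13) ^ 3 * p ^ 2)
    ≡⟨ expandˡ q p 13 ⟩
  2 * (q ^ 3 * p ^ 2) + 78 * (q ^ 2 * p ^ 2) + (1014 * q + 4394) * p ^ 2
    ≤⟨ +-monoʳ-≤ _ (*-monoˡ-≤ (p ^ 2) small) ⟩
  2 * (q ^ 3 * p ^ 2) + 78 * (q ^ 2 * p ^ 2) + q * q * p ^ 2
    ≡⟨ cong (2 * (q ^ 3 * p ^ 2) + 78 * (q ^ 2 * p ^ 2) +_) (regroup q p) ⟩
  2 * (q ^ 3 * p ^ 2) + 78 * (q ^ 2 * p ^ 2) + q ^ 2 * p * p
    ≤⟨ +-monoʳ-≤ _ (*-monoʳ-≤ (q ^ 2 * p) p≤2t) ⟩
  2 * (q ^ 3 * p ^ 2) + 78 * (q ^ 2 * p ^ 2) + q ^ 2 * p * (2 * t)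
    <⟨ m<m+n _ {2 * q ^ 3} (*-mono-≤ {1} {2} (s≤s z≤n) (m^n>0 q {{>-nonZero (≤-trans (s≤s z≤n) big)}} 3)) ⟩
  2 * (q ^ 3 * p ^ 2) + 78 * (q ^ 2 * p ^ 2) + q ^ 2 * p * (2 * t) + 2 * q ^ 3
    ≡⟨ collect q p t 39 ⟩
  2 * (q ^ 3 * p ^ 2 + (39 * p + t) * (q ^ 2 * p) + q ^ 3)
    ≡⟨ cong (λ x → 2 * (q ^ 3 * p ^ 2 + x * (q ^ 2 * p) + q ^ 3)) (sym eq₂) ⟩
  2 * (q ^ 3 * p ^ 2 + 2 * q * (q ^ 2 * p) + q ^ 3)
    ≡⟨ cong (2 *_) (expandʳ q p) ⟩
  2 * (q ^ 3 * (1 + p) ^ 2) ∎)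
  where
  open ≤-Reasoning
  open +-*-Solver
  expandˡ : ∀ q p d → 2 * ((q + d) ^ 3 * p ^ 2) ≡
    2 * (q ^ 3 * p ^ 2) + 6 * d * (q ^ 2 * p ^ 2) + (6 * d ^ 2 * q + 2 * d ^ 3) * p ^ 2
  expandˡ = solve 3 (λ q p d → con 2 :* ((q :+ d) :^ 3 :* p :^ 2) :=
    con 2 :* (q :^ 3 :* p :^ 2) :+ con 6 :* d :* (q :^ 2 :* p :^ 2) :+ (con 6 :* d :^ 2 :* q :+ con 2 :* d :^ 3) :* p :^ 2) refl
  regroup : ∀ q p → q * q * p ^ 2 ≡ q ^ 2 * p * p
  regroup = solve 2 (λ q p → q :* q :* p :^ 2 := q :^ 2 :* p :* p) refl
  collect : ∀ q p t c → 2 * (q ^ 3 * p ^ 2) + 2 * c * (q ^ 2 * p ^ 2) + q ^ 2 * p * (2 * t) + 2 * q ^ 3 ≡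
    2 * (q ^ 3 * p ^ 2 + (c * p + t) * (q ^ 2 * p) + q ^ 3)
  collect = solve 4 (λ q p t c → con 2 :* (q :^ 3 :* p :^ 2) :+ con 2 :* c :* (q :^ 2 :* p :^ 2) :+ q :^ 2 :* p :* (con 2 :* t) :+ con 2 :* q :^ 3 :=
    con 2 :* (q :^ 3 :* p :^ 2 :+ (c :* p :+ t) :* (q :^ 2 :* p) :+ q :^ 3)) refl
  expandʳ : ∀ q p → q ^ 3 * p ^ 2 + 2 * q * (q ^ 2 * p) + q ^ 3 ≡ q ^ 3 * (1 + p) ^ 2
  expandʳ = solve 2 (λ q p → q :^ 3 :* p :^ 2 :+ con 2 :* q :* (q :^ 2 :* p) :+ q :^ 3 := q :^ 3 :* (con 1 :+ p) :^ 2) refl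
  -- The coefficients are 6 · 13² and 2 · 13³, from doubling (q + 13)³. With 1020 = 1014 + 6 it is
  -- enough that 6 · 1020 exceeds 4394.
  small : 1014 * q + 4394 ≤ q * q
  small = begin
    1014 * q + 4394      ≤⟨ +-monoʳ-≤ (1014 * q) (≤-trans (m≤m+n 4394 1726) (*-monoʳ-≤ 6 big)) ⟩
    1014 * q + 6 * q     ≡⟨ sym (*-distribʳ-+ q 1014 6) ⟩
    1020 * q             ≤⟨ *-monoˡ-≤ q big ⟩
    q * q                ∎

-- Origin of the threshold 53 for `s`: with t = p - 26, the condition p ≤ 2 t says exactly p ≥ 52,
-- and then q ≥ 1027.
quintic-witness : ∀ p → 52 ≤ p → ∃₂ λ t q → q + 13 ≡ 20 * p × 2 * q ≡ 39 * p + t × p ≤ 2 * t × 1020 ≤ q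
quintic-witness p 52≤p = t , q , eq₁ , eq₂ , p≤2t , big
  where
  t = p ∸ 26
  q = 20 * p ∸ 13
  open ≤-Reasoning
  20*52≤ : 20 * 52 ≤ 20 * p
  20*52≤ = *-monoʳ-≤ 20 52≤p
  t+26 : t + 26 ≡ p
  t+26 = m∸n+n≡m (≤-trans (m≤m+n 26 26) 52≤p)
  eq₁ : q + 13 ≡ 20 * p
  eq₁ = m∸n+n≡m (≤-trans (≤ᵇ⇒≤ 13 (20 * 52) tt) 20*52≤)
  eq₂ : 2 * q ≡ 39 * p + t
  eq₂ = +-cancelʳ-≡ 26 _ _ (begin-equality
    2 * q + 26            ≡⟨ sym (*-distribˡ-+ 2 q 13) ⟩
    2 * (q + 13)          ≡⟨ cong (2 *_) eq₁ ⟩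
    2 * (20 * p)          ≡⟨ sym (*-assoc 2 20 p) ⟩
    (39 + 1) * p          ≡⟨ *-distribʳ-+ p 39 1 ⟩
    39 * p + 1 * p        ≡⟨ cong (39 * p +_) (trans (*-identityˡ p) (sym t+26)) ⟩
    39 * p + (t + 26)     ≡⟨ sym (+-assoc (39 * p) t 26) ⟩
    39 * p + t + 26       ∎)
  p≤2t : p ≤ 2 * t
  p≤2t = begin
    p            ≡⟨ sym t+26 ⟩
    t + 26       ≤⟨ +-monoʳ-≤ t (∸-monoˡ-≤ 26 52≤p) ⟩
    t + t        ≡⟨ cong (t +_) (sym (+-identityʳ t)) ⟩
    2 * t        ∎
  big : 1020 ≤ q
  big = ≤-trans (≤ᵇ⇒≤ 1020 (20 * 52 ∸ 13) tt) (∸-monoˡ-≤ 13 20*52≤)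

-- Deleting a vertex on each side loses less than (13/20 + 1) E/s, so x ≥ (1 - 33/(20 s)) E;
-- maximality allows only x ≤ (1 - 1/s)^(5/3) E. As 33/20 < 5/3, these clash for large `s`, which is
-- what `quintic` makes explicit.
degree-absurd : ∀ p s t q E x d₁ d₂ → s ≡ 1 + p → q + 13 ≡ 20 * p → 2 * q ≡ 39 * p + t → p ≤ 2 * t → 1020 ≤ q →
  0 < E → E ≤ x + d₁ + d₂ → s * d₂ ≤ E → x ^ 3 * s ^ 5 ≤ E ^ 3 * p ^ 5 → 20 * (s * d₁) < 13 * E → ⊥
degree-absurd p s t q E x d₁ d₂ s≡ eq₁ eq₂ p≤2t big 0<E total low dense bad = <-irrefl refl absurd
  where
  open ≤-Reasoning
  linear : q * E ≤ 20 * (s * x)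
  linear = +-cancelʳ-≤ (33 * E) _ _ (begin
    q * E + 33 * E                                ≡⟨ sym (*-distribʳ-+ E q 33) ⟩
    (q + 33) * E                                  ≡⟨ cong (_* E) (trans (sym (+-assoc q 13 20)) (trans (cong (_+ 20) eq₁) (trans (+-comm (20 * p) 20) (trans (sym (*-suc 20 p)) (cong (20 *_) (sym s≡)))))) ⟩
    20 * s * E                                    ≤⟨ *-monoʳ-≤ (20 * s) total ⟩
    20 * s * (x + d₁ + d₂)                        ≡⟨ distribute 20 s x d₁ d₂ ⟩
    20 * (s * x) + (20 * (s * d₁) + 20 * (s * d₂)) ≤⟨ +-monoʳ-≤ (20 * (s * x)) (+-mono-≤ (<⇒≤ bad) (*-monoʳ-≤ 20 low)) ⟩
    20 * (s * x) + (13 * E + 20 * E)              ≡⟨ cong (20 * (s * x) +_) (sym (*-distribʳ-+ E 13 20)) ⟩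
    20 * (s * x) + 33 * E                         ∎)
    where
    distribute : ∀ c s x y z → c * s * (x + y + z) ≡ c * (s * x) + (c * (s * y) + c * (s * z))
    distribute = solve 5 (λ c s x y z → c :* s :* (x :+ y :+ z) := c :* (s :* x) :+ (c :* (s :* y) :+ c :* (s :* z))) refl
      where open +-*-Solver
  shape₁ : ∀ c s x → (c * (s * x)) ^ 3 * s ^ 2 ≡ c ^ 3 * (x ^ 3 * s ^ 5)
  shape₁ = solve 3 (λ c s x → (c :* (s :* x)) :^ 3 :* s :^ 2 := c :^ 3 :* (x :^ 3 :* s :^ 5)) refl
    where open +-*-Solver
  shape₂ : ∀ c e p → c ^ 3 * (e ^ 3 * p ^ 5) ≡ e ^ 3 * ((c * p) ^ 3 * p ^ 2)
  shape₂ = solve 3 (λ c e p → c :^ 3 :* (e :^ 3 :* p :^ 5) := e :^ 3 :* ((c :* p) :^ 3 :* p :^ 2)) refl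
    where open +-*-Solver
  shape₃ : ∀ q e s → e ^ 3 * (q ^ 3 * s ^ 2) ≡ (q * e) ^ 3 * s ^ 2
  shape₃ = solve 3 (λ q e s → e :^ 3 :* (q :^ 3 :* s :^ 2) := (q :* e) :^ 3 :* s :^ 2) refl
    where open +-*-Solver
  absurd : (q * E) ^ 3 * s ^ 2 < (q * E) ^ 3 * s ^ 2
  absurd = begin-strict
    (q * E) ^ 3 * s ^ 2                ≤⟨ *-monoˡ-≤ (s ^ 2) (^-monoˡ-≤ 3 linear) ⟩
    (20 * (s * x)) ^ 3 * s ^ 2         ≡⟨ shape₁ 20 s x ⟩
    20 ^ 3 * (x ^ 3 * s ^ 5)           ≤⟨ *-monoʳ-≤ (20 ^ 3) dense ⟩
    20 ^ 3 * (E ^ 3 * p ^ 5)           ≡⟨ shape₂ 20 E p ⟩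
    E ^ 3 * ((20 * p) ^ 3 * p ^ 2)     <⟨ *-monoʳ-< (E ^ 3) {{>-nonZero (^-pos 3 0<E)}} (subst (λ x → (20 * p) ^ 3 * p ^ 2 < q ^ 3 * x ^ 2) (sym s≡) (quintic p t q eq₁ eq₂ p≤2t big)) ⟩
    E ^ 3 * (q ^ 3 * s ^ 2)            ≡⟨ shape₃ q E s ⟩
    (q * E) ^ 3 * s ^ 2                ∎

degree-arith : ∀ p s E x d₁ d₂ → s ≡ 1 + p → 52 ≤ p → 0 < E → E ≤ x + d₁ + d₂ → s * d₂ ≤ E →
  x ^ 3 * s ^ 5 ≤ E ^ 3 * p ^ 5 → 13 * E ≤ 20 * (s * d₁)
degree-arith p s E x d₁ d₂ s≡ 52≤p 0<E total low dense = ≮⇒≥ λ bad →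
  let t , q , eq₁ , eq₂ , p≤2t , big = quintic-witness p 52≤p
  in degree-absurd p s t q E x d₁ d₂ s≡ eq₁ eq₂ p≤2t big 0<E total low dense bad

-- From y ≤ (b E / s) (a / s)^(2/3), since 16/25 > 4^(-1/3).
sparse-arith : ∀ a b s E y y₀ → 0 < s → (a ≡ 0 → y ≡ 0) → 2 * a ≤ s → a * y ≤ b * y₀ →
  y₀ ^ 3 * s ^ 5 ≤ E ^ 3 * a ^ 5 → 25 * (s * y) ≤ 16 * (b * E)
sparse-arith zero b s E y y₀ 0<s zero-case _ _ _ rewrite zero-case refl | *-zeroʳ s = z≤n
sparse-arith a@(suc _) b s E y y₀ 0<s _ 2a≤s avg dense =
  ^-cancelʳ-≤ 3 (*-cancelˡ-≤ 4 (begin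
    4 * (25 * (s * y)) ^ 3       ≡⟨ pull 4 25 (s * y) ⟩
    25 ^ 3 * (4 * (s * y) ^ 3)   ≤⟨ *-monoʳ-≤ (25 ^ 3) root ⟩
    25 ^ 3 * (b * E) ^ 3         ≤⟨ *-monoˡ-≤ ((b * E) ^ 3) (≤ᵇ⇒≤ (25 ^ 3) (4 * 16 ^ 3) tt) ⟩
    4 * 16 ^ 3 * (b * E) ^ 3     ≡⟨ sym (push 4 16 (b * E)) ⟩
    4 * (16 * (b * E)) ^ 3       ∎))
  where
  open ≤-Reasoning
  pull : ∀ c d z → c * (d * z) ^ 3 ≡ d ^ 3 * (c * z ^ 3)
  pull = solve 3 (λ c d z → c :* (d :* z) :^ 3 := d :^ 3 :* (c :* z :^ 3)) refl
    where open +-*-Solver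
  push : ∀ c d z → c * (d * z) ^ 3 ≡ c * d ^ 3 * z ^ 3
  push = solve 3 (λ c d z → c :* (d :* z) :^ 3 := c :* d :^ 3 :* z :^ 3) refl
    where open +-*-Solver
  shape₁ : ∀ a y s → a ^ 3 * (y ^ 3 * s ^ 5) ≡ (a * y) ^ 3 * s ^ 5
  shape₁ = solve 3 (λ a y s → a :^ 3 :* (y :^ 3 :* s :^ 5) := (a :* y) :^ 3 :* s :^ 5) refl
    where open +-*-Solver
  shape₂ : ∀ b y s → (b * y) ^ 3 * s ^ 5 ≡ b ^ 3 * (y ^ 3 * s ^ 5)
  shape₂ = solve 3 (λ b y s → (b :* y) :^ 3 :* s :^ 5 := b :^ 3 :* (y :^ 3 :* s :^ 5)) refl
    where open +-*-Solver
  shape₃ : ∀ a b e → b ^ 3 * (e ^ 3 * a ^ 5) ≡ a ^ 3 * ((b * e) ^ 3 * a ^ 2)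
  shape₃ = solve 3 (λ a b e → b :^ 3 :* (e :^ 3 :* a :^ 5) := a :^ 3 :* ((b :* e) :^ 3 :* a :^ 2)) refl
    where open +-*-Solver
  cubed : y ^ 3 * s ^ 5 ≤ (b * E) ^ 3 * a ^ 2
  cubed = *-cancelˡ-≤ (a ^ 3) {{>-nonZero (^-pos {a} 3 (s≤s z≤n))}} (begin
    a ^ 3 * (y ^ 3 * s ^ 5)        ≡⟨ shape₁ a y s ⟩
    (a * y) ^ 3 * s ^ 5            ≤⟨ *-monoˡ-≤ (s ^ 5) (^-monoˡ-≤ 3 avg) ⟩
    (b * y₀) ^ 3 * s ^ 5           ≡⟨ shape₂ b y₀ s ⟩
    b ^ 3 * (y₀ ^ 3 * s ^ 5)       ≤⟨ *-monoʳ-≤ (b ^ 3) dense ⟩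
    b ^ 3 * (E ^ 3 * a ^ 5)        ≡⟨ shape₃ a b E ⟩
    a ^ 3 * ((b * E) ^ 3 * a ^ 2)  ∎)
  shape₄ : ∀ c s y → s ^ 2 * (c * (s * y) ^ 3) ≡ c * (y ^ 3 * s ^ 5)
  shape₄ = solve 3 (λ c s y → s :^ 2 :* (c :* (s :* y) :^ 3) := c :* (y :^ 3 :* s :^ 5)) refl
    where open +-*-Solver
  shape₅ : ∀ a z → 4 * (z * a ^ 2) ≡ (2 * a) ^ 2 * z
  shape₅ = solve 2 (λ a z → con 4 :* (z :* a :^ 2) := (con 2 :* a) :^ 2 :* z) refl
    where open +-*-Solver
  root : 4 * (s * y) ^ 3 ≤ (b * E) ^ 3
  root = *-cancelˡ-≤ (s ^ 2) {{>-nonZero (^-pos 2 0<s)}} (begin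
    s ^ 2 * (4 * (s * y) ^ 3)      ≡⟨ shape₄ 4 s y ⟩
    4 * (y ^ 3 * s ^ 5)            ≤⟨ *-monoʳ-≤ 4 cubed ⟩
    4 * ((b * E) ^ 3 * a ^ 2)      ≡⟨ shape₅ a ((b * E) ^ 3) ⟩
    (2 * a) ^ 2 * (b * E) ^ 3      ≤⟨ *-monoˡ-≤ ((b * E) ^ 3) (^-monoˡ-≤ 2 2a≤s) ⟩
    s ^ 2 * (b * E) ^ 3            ∎)

-- In hundredths, 13/20 is 65 and 16/25 is 64; the difference is the 1/100 that governs the number
-- of matchings.
expansion-arith : ∀ E b s y z → 13 * E * b ≤ 20 * (s * (z + y)) → 25 * (s * y) ≤ 16 * (b * E) →
  E * b ≤ 100 * (s * z)
expansion-arith E b s y z deg sparse = +-cancelˡ-≤ (64 * (b * E)) _ _ (begin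
  64 * (b * E) + E * b                   ≡⟨ shape₁ E b ⟩
  5 * (13 * E * b)                       ≤⟨ *-monoʳ-≤ 5 deg ⟩
  5 * (20 * (s * (z + y)))               ≡⟨ shape₂ s y z ⟩
  4 * (25 * (s * y)) + 100 * (s * z)     ≤⟨ +-monoˡ-≤ _ (*-monoʳ-≤ 4 sparse) ⟩
  4 * (16 * (b * E)) + 100 * (s * z)     ≡⟨ cong (_+ 100 * (s * z)) (sym (*-assoc 4 16 (b * E))) ⟩
  64 * (b * E) + 100 * (s * z)           ∎)
  where
  open ≤-Reasoning
  open +-*-Solver
  shape₁ : ∀ e b → 64 * (b * e) + e * b ≡ 5 * (13 * e * b)
  shape₁ = solve 2 (λ e b → con 64 :* (b :* e) :+ e :* b := con 5 :* (con 13 :* e :* b)) refl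
  shape₂ : ∀ s y z → 5 * (20 * (s * (z + y))) ≡ 4 * (25 * (s * y)) + 100 * (s * z)
  shape₂ = solve 3 (λ s y z → con 5 :* (con 20 :* (s :* (z :+ y))) := con 4 :* (con 25 :* (s :* y)) :+ con 100 :* (s :* z)) refl

-- Dense pairs and their expansion

between<⇒∃ : (w w′ : Fin n → Fin n → ℕ) (S T : Subset n) → between w S T < between w′ S T →
  ∃₂ λ u v → u ∈ S × v ∈ T × w u v < w′ u v
between<⇒∃ w w′ S T p =
  let u , q = ∑<∑⇒∃ _ _ p
      u∈ , r = χ-<⇒ S u q
      v , q′ = ∑<∑⇒∃ _ _ r
      v∈ , r′ = χ-<⇒ T v q′
  in u , v , u∈ , v∈ , r′
  where
  χ-<⇒ : ∀ S u {x y} → χ S u * x < χ S u * y → u ∈ S × x < y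
  χ-<⇒ S u {x} {y} p = aux (lookup S u) refl p
    where
    aux : ∀ b → lookup S u ≡ b → ⟦ b ⟧ * x < ⟦ b ⟧ * y → u ∈ S × x < y
    aux true eq q = lookup⇒[]= u S eq , *-cancelˡ-< 1 x y q

between-transpose : (w : Fin n → Fin n → ℕ) (S T : Subset n) → between w S T ≡ between (flip w) T S
between-transpose {n} w S T = begin
  ∑ (λ u → χ S u * ∑ λ v → χ T v * w u v)   ≡⟨ ∑-cong (λ u → sym (∑-*ˡ (χ S u) (λ v → χ T v * w u v))) ⟩
  ∑ (λ u → ∑ λ v → χ S u * (χ T v * w u v)) ≡⟨ ∑-swap (λ u v → χ S u * (χ T v * w u v)) ⟩
  ∑ (λ v → ∑ λ u → χ S u * (χ T v * w u v)) ≡⟨ ∑-cong (λ v → ∑-cong (λ u → *-exchange (χ S u) (χ T v) (w u v))) ⟩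
  ∑ (λ v → ∑ λ u → χ T v * (χ S u * w u v)) ≡⟨ ∑-cong (λ v → ∑-*ˡ (χ T v) (λ u → χ S u * w u v)) ⟩
  ∑ (λ v → χ T v * ∑ λ u → χ S u * w u v)   ∎
  where
  open ≡-Reasoning

module _ (G : Graph n) where

  weight : Fin n → Fin n → ℕ
  weight u v = ⟦ adj G u v ⟧

  e : Subset n → Subset n → ℕ
  e = between weight

  e-comm : ∀ S T → e S T ≡ e T S
  e-comm S T = trans (between-transpose weight S T)
    (∑∈-cong T λ v → ∑∈-cong S λ u → cong ⟦_⟧ (Graph.sym G u v))

  e-splitˡ : ∀ {A S X} → Split A S X → ∀ T → e A T ≡ e S T + e X T
  e-splitˡ sp T = split-∑∈ sp (λ u → ∑∈ T (weight u))

  e-splitʳ : ∀ {B T Y} → Split B T Y → ∀ S → e S B ≡ e S T + e S Y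
  e-splitʳ {B} {T} {Y} sp S = trans (e-comm S B) (trans (e-splitˡ sp S) (cong₂ _+_ (e-comm T S) (e-comm Y S)))

  e-⁅⁆ : ∀ v T → e ⁅ v ⁆ T ≡ ∑∈ T (weight v)
  e-⁅⁆ v T = ∑∈-⁅⁆ v (λ u → ∑∈ T (weight u))

  e≤ : ∀ S T → e S T ≤ # S * # T
  e≤ S T = begin
    e S T                 ≤⟨ ∑∈-mono S (λ u _ → ∑∈-mono T (λ v _ → ⟦⟧≤1 (adj G u v))) ⟩
    ∑∈ S (λ _ → ∑∈ T (λ _ → 1)) ≡⟨ ∑∈-const S _ ⟩
    ∑∈ T (λ _ → 1) * # S  ≡⟨ cong (_* # S) (trans (∑∈-const T 1) (*-identityˡ _)) ⟩
    # T * # S             ≡⟨ *-comm (# T) (# S) ⟩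
    # S * # T             ∎
    where open ≤-Reasoning

  -- Maximality of e(A,B) / s^(5/3), cubed.
  record DensePair (A B : Subset n) (s : ℕ) : Set where
    field
      cardˡ   : # A ≡ s
      cardʳ   : # B ≡ s
      maximal : ∀ S T σ → S ⊆ A → T ⊆ B → # S ≡ σ → # T ≡ σ → σ < s →
        e S T ^ 3 * s ^ 5 ≤ e A B ^ 3 * σ ^ 5
  open DensePair

  densePair-swap : ∀ {A B s} → DensePair A B s → DensePair B A s
  densePair-swap {A} {B} {s} D = record
    { cardˡ   = cardʳ D
    ; cardʳ   = cardˡ D
    ; maximal = λ S T σ p q c d lt → subst₂ (λ x y → x ^ 3 * s ^ 5 ≤ y ^ 3 * σ ^ 5)
        (e-comm T S) (e-comm A B) (maximal D T S σ q p d c lt)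
    }

  Denser : Subset n → Subset n → ℕ → Subset n → Subset n → Set
  Denser A B s S T = S ⊆ A × T ⊆ B × # T ≡ # S × # S < s × e A B ^ 3 * # S ^ 5 < e S T ^ 3 * s ^ 5

  denser? : ∀ A B s → Dec (∃₂ (Denser A B s))
  denser? A B s = anySubset? λ S → anySubset? λ T →
    (S ⊆? A) ×-dec (T ⊆? B) ×-dec (# T ≟ # S) ×-dec (# S <? s)
      ×-dec (e A B ^ 3 * # S ^ 5 <? e S T ^ 3 * s ^ 5)

  record DenseSubpair (A B : Subset n) (s : ℕ) : Set where
    field
      {A′ B′} : Subset n
      {s′}    : ℕ
      dense   : DensePair A′ B′ s′
      A′⊆A    : A′ ⊆ A
      B′⊆B    : B′ ⊆ B
      0<s⇒0<s′ : 0 < s → 0 < s′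
      denser  : s′ ^ 5 * e A B ^ 3 ≤ s ^ 5 * e A′ B′ ^ 3
  open DenseSubpair

  -- Passing to a smaller, strictly denser subpair must stop, because the size drops each time.
  -- Where it stops the pair is maximal among its own subpairs, which is all that `DensePair` asks.
  ∃-densePair : ∀ k s A B → s ≤ k → # A ≡ s → # B ≡ s → DenseSubpair A B s
  ∃-densePair k s A B s≤k cA cB = go k s A B s≤k cA cB (denser? A B s)
    where
    go : ∀ k s A B → s ≤ k → # A ≡ s → # B ≡ s → Dec (∃₂ (Denser A B s)) → DenseSubpair A B s
    go k s A B s≤k cA cB (no none) = record
      { dense  = record
        { cardˡ = cA ; cardʳ = cB
        ; maximal = λ S T σ p q c d lt → ≮⇒≥ λ bad → none (S , T , p , q , trans d (sym c)
            , subst (_< s) (sym c) lt , subst (λ x → e A B ^ 3 * x ^ 5 < e S T ^ 3 * s ^ 5) (sym c) bad) }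
      ; A′⊆A   = ⊆-refl
      ; B′⊆B   = ⊆-refl
      ; 0<s⇒0<s′ = λ p → p
      ; denser = ≤-refl
      }
    go zero zero A B s≤k cA cB (yes (S , T , _ , _ , _ , () , _))
    go (suc k) s A B s≤k cA cB (yes (S , T , S⊆A , T⊆B , cT , lt , better)) = record
      { dense  = dense D
      ; A′⊆A   = ⊆-trans (A′⊆A D) S⊆A
      ; B′⊆B   = ⊆-trans (B′⊆B D) T⊆B
      ; 0<s⇒0<s′ = λ _ → 0<s⇒0<s′ D 0<S
      ; denser = ≤-compose-ratios (s′ D ^ 5) (s ^ 5) (# S ^ 5) (e A B ^ 3) (e S T ^ 3) (e (A′ D) (B′ D) ^ 3)
          (λ z → contradiction z (>⇒≢ (^-pos 5 0<S)))
          (subst₂ _≤_ (*-comm (e A B ^ 3) (# S ^ 5)) (*-comm (e S T ^ 3) (s ^ 5)) (<⇒≤ better))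
          (denser D)
      }
      where
      D = go k (# S) S T (s≤s⁻¹ (≤-trans lt s≤k)) refl cT (denser? S T (# S))
      0<S : 0 < # S
      0<S = n≢0⇒n>0 λ z → contradiction
        (≤-trans better (≤-reflexive (cong (λ x → x ^ 3 * s ^ 5)
          (n≤0⇒n≡0 (≤-trans (e≤ S T) (≤-reflexive (cong (_* # T) z))))))) λ ()

  module _ {A B : Subset n} {s : ℕ} (D : DensePair A B s) (53≤s : 53 ≤ s) (0<E : 0 < e A B) where

    private E = e A B

    -- A vertex `w` of at most average degree is deleted together with `v` to keep the pair
    -- balanced; it costs at most E/s edges, so the rest of the loss that maximality forces must
    -- come from `v`.
    degreeˡ : ∀ v → v ∈ A → 13 * E ≤ 20 * (s * ∑∈ B (weight v))
    degreeˡ v v∈A = degree-arith p s E (e A⁻ B⁻) (∑∈ B (weight v)) (∑∈ A (weight w)) s≡ 52≤p 0<E total low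
      (maximal D A⁻ B⁻ p (split-⊆ʳ spA) (split-⊆ʳ spB) cA⁻ cB⁻ (≤-reflexive (sym s≡)))
      where
      p = s ∸ 1
      s≡ : s ≡ 1 + p
      s≡ = sym (m+[n∸m]≡n (≤-trans (s≤s z≤n) 53≤s))
      52≤p : 52 ≤ p
      52≤p = ∸-monoˡ-≤ 1 53≤s
      avg = ∃-below-average B (λ w → ∑∈ A (weight w)) (subst (0 <_) (sym (cardʳ D)) (≤-trans (s≤s z≤n) 53≤s))
      w = proj₁ avg
      w∈B : w ∈ B
      w∈B = proj₁ (proj₂ avg)
      A⁻ = A ∖ ⁅ v ⁆
      B⁻ = B ∖ ⁅ w ⁆
      spA : Split A ⁅ v ⁆ A⁻
      spA = ∖-split (⁅⁆⊆ v∈A)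
      spB : Split B ⁅ w ⁆ B⁻
      spB = ∖-split (⁅⁆⊆ w∈B)
      cA⁻ : # A⁻ ≡ p
      cA⁻ = suc-injective (trans (cong (_+ # A⁻) (sym (#-⁅⁆ v))) (trans (sym (split-card spA)) (trans (cardˡ D) s≡)))
      cB⁻ : # B⁻ ≡ p
      cB⁻ = suc-injective (trans (cong (_+ # B⁻) (sym (#-⁅⁆ w))) (trans (sym (split-card spB)) (trans (cardʳ D) s≡)))
      low : s * ∑∈ A (weight w) ≤ E
      low = subst₂ (λ x y → x * ∑∈ A (weight w) ≤ y) (cardʳ D) (e-comm B A) (proj₂ (proj₂ avg))
      open ≤-Reasoning
      total : E ≤ e A⁻ B⁻ + ∑∈ B (weight v) + ∑∈ A (weight w)
      total = begin
        e A B                                         ≡⟨ e-splitˡ spA B ⟩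
        e ⁅ v ⁆ B + e A⁻ B                            ≡⟨ cong₂ _+_ (e-⁅⁆ v B) (e-splitʳ spB A⁻) ⟩
        ∑∈ B (weight v) + (e A⁻ ⁅ w ⁆ + e A⁻ B⁻)      ≤⟨ +-monoʳ-≤ (∑∈ B (weight v)) (+-monoˡ-≤ (e A⁻ B⁻) small) ⟩
        ∑∈ B (weight v) + (∑∈ A (weight w) + e A⁻ B⁻) ≡⟨ rotate (∑∈ B (weight v)) (∑∈ A (weight w)) (e A⁻ B⁻) ⟩
        e A⁻ B⁻ + ∑∈ B (weight v) + ∑∈ A (weight w)   ∎
        where
        rotate : ∀ x y z → x + (y + z) ≡ z + x + y
        rotate = solve 3 (λ x y z → x :+ (y :+ z) := z :+ x :+ y) refl
          where open +-*-Solver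
        small : e A⁻ ⁅ w ⁆ ≤ ∑∈ A (weight w)
        small = ≤-trans (≤-reflexive (trans (e-comm A⁻ ⁅ w ⁆) (e-⁅⁆ w A⁻)))
          (∑-mono λ u → *-monoˡ-≤ (weight w u) (χ-mono {S = A⁻} {A} (split-⊆ʳ spA) u))

  -- The vertices of `T` send at least (13/20) |T| E/s edges into `A`. At most (16/25) |T| E/s of
  -- them end in `X`: a heavy subset of `T` of size |X| forms with `X` a balanced pair, to which
  -- maximality applies. The others end in `S`.
  expansion : ∀ {A B s} → DensePair A B s → 53 ≤ s → 0 < e A B → ∀ {S T X} → Split A S X → T ⊆ B →
    # X ≤ # T → 2 * # X ≤ s → e A B * # T ≤ 100 * (s * e S T)
  expansion {A} {B} {s} D 53≤s 0<E {S} {T} {X} sp T⊆B a≤b 2a≤s =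
    expansion-arith E (# T) s (e X T) (e S T) degrees sparse
    where
    E = e A B
    0<s : 0 < s
    0<s = ≤-trans (s≤s z≤n) 53≤s
    heavy = ∃-heavy-subset (# T ∸ # X) (# X) T (λ v → ∑∈ X (weight v)) (sym (m∸n+n≡m a≤b))
    T₀ = proj₁ heavy
    T₀⊆T : T₀ ⊆ T
    T₀⊆T = proj₁ (proj₂ heavy)
    a<s : # X < s
    a<s = half< (# X) 2a≤s 0<s
      where
      half< : ∀ a {s} → 2 * a ≤ s → 0 < s → a < s
      half< zero    _ q = q
      half< (suc a) p _ = ≤-trans (s≤s (m<m+n a {suc (a + 0)} z<s)) p
    sparse : 25 * (s * e X T) ≤ 16 * (# T * E)
    sparse = sparse-arith (# X) (# T) s E (e X T) (e X T₀) 0<s zero-case 2a≤s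
      (subst₂ (λ x y → # X * x ≤ # T * y) (e-comm T X) (e-comm T₀ X) (proj₂ (proj₂ (proj₂ heavy))))
      (maximal D X T₀ (# X) (split-⊆ʳ sp) (⊆-trans T₀⊆T T⊆B) refl (proj₁ (proj₂ (proj₂ heavy))) a<s)
      where
      zero-case : # X ≡ 0 → e X T ≡ 0
      zero-case z = n≤0⇒n≡0 (≤-trans (e≤ X T) (≤-reflexive (cong (_* # T) z)))
    open ≤-Reasoning
    degrees : 13 * E * # T ≤ 20 * (s * (e S T + e X T))
    degrees = begin
      13 * E * # T                                  ≡⟨ sym (∑∈-const T (13 * E)) ⟩
      ∑∈ T (λ _ → 13 * E)                           ≤⟨ ∑∈-mono T deg ⟩
      ∑∈ T (λ v → 20 * (s * ∑∈ A (weight v)))       ≡⟨ ∑∈-*ˡ T 20 (λ v → s * ∑∈ A (weight v)) ⟩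
      20 * ∑∈ T (λ v → s * ∑∈ A (weight v))         ≡⟨ cong (20 *_) (∑∈-*ˡ T s (λ v → ∑∈ A (weight v))) ⟩
      20 * (s * e T A)                              ≡⟨ cong (λ x → 20 * (s * x)) (trans (e-comm T A) (e-splitˡ sp T)) ⟩
      20 * (s * (e S T + e X T))                    ∎
      where
      deg : ∀ v → v ∈ T → 13 * E ≤ 20 * (s * ∑∈ A (weight v))
      deg v p = subst (λ x → 13 * x ≤ 20 * (s * ∑∈ A (weight v))) (e-comm B A)
        (degreeˡ (densePair-swap D) 53≤s (subst (0 <_) (e-comm A B) 0<E) v (T⊆B p))

-- Layers of edge-disjoint perfect matchings

-- A row (or column) of a colour matrix: if c = 1 the colours 1, …, k occur once each; if c = 0 none does.
record Line (k c : ℕ) (f : Fin n → ℕ) : Set where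
  field
    bounded   : ∀ i → f i ≤ k
    injective : ∀ i j → 0 < f i → f i ≡ f j → i ≡ j
    full      : 0 < c → ∀ x → 0 < x → x ≤ k → ∃[ i ] f i ≡ x
    count     : ∑ (λ i → sg (f i)) ≡ k * c
open Line

line-pos : ∀ {k c} {f : Fin n → ℕ} → Line k c f → ∀ i → 0 < f i → 0 < c
line-pos {k = k} {c} {f} L i p = n≢0⇒n>0 λ z → contradiction (begin
  1                        ≡⟨ sym (sg-pos p) ⟩
  sg (f i)                 ≤⟨ f≤∑f (λ i → sg (f i)) i ⟩
  ∑ (λ i → sg (f i))       ≡⟨ trans (count L) (trans (cong (k *_) z) (*-zeroʳ k)) ⟩
  0                        ∎) λ ()
  where open ≤-Reasoning

-- As c ≤ 1, `m` marks at most one position, and one that is still 0. It receives the new colour k +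
-- 1 and all other entries stay as they are.
line-extend : ∀ {k c} {f : Fin n → ℕ} (m : Fin n → ℕ) → Line k c f → c ≤ 1 → ∑ m ≡ c →
  (∀ i → 0 < m i → f i ≡ 0) → Line (suc k) c (λ i → f i + suc k * m i)
line-extend {n} {k} {c} {f} m L c≤1 ∑m off = record
  { bounded = bounded′ ; injective = injective′ ; full = full′ ; count = count′ }
  where
  g : Fin n → ℕ
  g i = f i + suc k * m i
  m≤1 : ∀ i → m i ≤ 1
  m≤1 i = ≤-trans (f≤∑f m i) (≤-trans (≤-reflexive ∑m) c≤1)
  data Case (i : Fin n) : Set where
    old : m i ≡ 0 → g i ≡ f i → Case i
    new : m i ≡ 1 → f i ≡ 0 → g i ≡ suc k → Case i
  case : ∀ i → Case i
  case i = aux (m i) refl (m≤1 i)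
    where
    aux : ∀ x → m i ≡ x → x ≤ 1 → Case i
    aux zero eq _ = old eq (trans (cong (λ x → f i + suc k * x) eq) (trans (cong (f i +_) (*-zeroʳ (suc k))) (+-identityʳ _)))
    aux (suc zero) eq _ = new eq fi (trans (cong₂ (λ x y → x + suc k * y) fi eq) (*-identityʳ (suc k)))
      where
      fi : f i ≡ 0
      fi = off i (subst (0 <_) (sym eq) z<s)
    aux (suc (suc _)) _ (s≤s ())
  bounded′ : ∀ i → g i ≤ suc k
  bounded′ i with case i
  ... | old _ eq   = subst (_≤ suc k) (sym eq) (m≤n⇒m≤1+n (bounded L i))
  ... | new _ _ eq = ≤-reflexive eq
  injective′ : ∀ i j → 0 < g i → g i ≡ g j → i ≡ j
  injective′ i j p eq with case i | case j
  ... | old _ a | old _ b = injective L i j (subst (0 <_) a p) (trans (sym a) (trans eq b))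
  ... | old _ a | new _ _ b = contradiction (trans (sym a) (trans eq b)) (<⇒≢ (s≤s (bounded L i)))
  ... | new _ _ a | old _ b = contradiction (trans (sym b) (trans (sym eq) a)) (<⇒≢ (s≤s (bounded L j)))
  ... | new mi _ _ | new mj _ _ with i Fin.≟ j
  ...   | yes i≡j = i≡j
  ...   | no i≢j = contradiction
            (≤-trans (≤-reflexive (cong₂ _+_ (sym mi) (sym mj))) (≤-trans (f+f≤∑f m i≢j) (≤-trans (≤-reflexive ∑m) c≤1)))
            λ { (s≤s ()) }
  full′ : 0 < c → ∀ x → 0 < x → x ≤ suc k → ∃[ i ] g i ≡ x
  full′ 0<c x 0<x x≤ with m≤n⇒m<n∨m≡n x≤
  ... | inj₁ (s≤s x≤k) with full L 0<c x 0<x x≤k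
  ...   | i , fi≡x with case i
  ...     | old _ eq   = i , trans eq fi≡x
  ...     | new _ z _ = contradiction (trans (sym fi≡x) z) (>⇒≢ 0<x)
  full′ 0<c x 0<x x≤ | inj₂ x≡ with 0<∑⇒∃ m (subst (0 <_) (sym ∑m) 0<c)
  ...   | i , 0<mi with case i
  ...     | old z _    = contradiction z (>⇒≢ 0<mi)
  ...     | new _ _ eq = i , trans eq (sym x≡)
  count′ : ∑ (λ i → sg (g i)) ≡ suc k * c
  count′ = begin
    ∑ (λ i → sg (g i))             ≡⟨ ∑-cong pointwise ⟩
    ∑ (λ i → m i + sg (f i))       ≡⟨ ∑-+ m (λ i → sg (f i)) ⟩
    ∑ m + ∑ (λ i → sg (f i))       ≡⟨ cong₂ _+_ ∑m (count L) ⟩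
    c + k * c                      ∎
    where
    open ≡-Reasoning
    pointwise : ∀ i → sg (g i) ≡ m i + sg (f i)
    pointwise i with case i
    ... | old z eq   = trans (cong sg eq) (cong (_+ sg (f i)) (sym z))
    ... | new o z eq = trans (cong sg eq) (cong₂ (λ x y → x + sg y) (sym o) (sym z))

module _ (G : Graph n) (A B : Subset n) (disjoint : Disjoint A B) where

  -- k edge-disjoint perfect matchings between A and B, the j-th one coloured j.
  record Layers (k : ℕ) : Set where
    field
      colours  : Fin n → Fin n → ℕ
      edges    : ∀ u v → 0 < colours u v → Edge G u v
      rowLines : ∀ u → Line k (χ A u) (colours u)
      colLines : ∀ v → Line k (χ B v) (λ u → colours u v)
  open Layers

  layers-zero : Layers 0
  layers-zero = record { colours = λ _ _ → 0 ; edges = λ _ _ () ; rowLines = λ _ → zeroLine ; colLines = λ _ → zeroLine }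
    where
    zeroLine : ∀ {c} → Line 0 c (λ (_ : Fin n) → 0)
    zeroLine = record
      { bounded = λ _ → z≤n ; injective = λ _ _ () ; count = ∑-zero {n} {λ _ → 0} λ _ → refl
      ; full = λ _ x p q → contradiction (≤-trans p q) λ () }

  unused : ∀ {k} → Layers k → Fin n → Fin n → Bool
  unused L u v = adj G u v ∧ (colours L u v ≡ᵇ 0)

  unused⇒ : ∀ {k} (L : Layers k) u v → unused L u v ≡ true → Edge G u v × colours L u v ≡ 0
  unused⇒ L u v = aux (adj G u v) (colours L u v)
    where
    aux : ∀ b x → b ∧ (x ≡ᵇ 0) ≡ true → b ≡ true × x ≡ 0
    aux true zero _ = refl , refl

  layers-suc : ∀ {k} (L : Layers k) → PerfectMatching (unused L) A B → Layers (suc k)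
  layers-suc {k} L M = record
    { colours  = λ u v → colours L u v + suc k * μ M u v
    ; edges    = edges′
    ; rowLines = λ u → line-extend (μ M u) (rowLines L u) (χ≤1 A u) (rows M u)
                   (λ v p → proj₂ (unused⇒ L u v (support M u v p)))
    ; colLines = λ v → line-extend (λ u → μ M u v) (colLines L v) (χ≤1 B v) (cols M v)
                   (λ u p → proj₂ (unused⇒ L u v (support M u v p)))
    }
    where
    edges′ : ∀ u v → 0 < colours L u v + suc k * μ M u v → Edge G u v
    edges′ u v p with μ M u v in eq
    ... | suc _ = proj₁ (unused⇒ L u v (support M u v (subst (0 <_) (sym eq) z<s)))
    ... | zero  = edges L u v (subst (0 <_) (trans (cong (colours L u v +_) (*-zeroʳ (suc k))) (+-identityʳ _)) p)

  -- Every vertex of `A` and `B` sees precisely the colours 1, ..., k. Disjointness of the sides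
  -- makes the direction from `A` to `B` a legitimate orientation.
  layers-piece : ∀ {k} → Layers k → Σ (Piece G) λ P → size P ≡ k * # A
  layers-piece {k} L = P , trans (∑-cong (λ u → count (rowLines L u))) (∑-*ˡ k (χ A))
    where
    P : Piece G
    P = record
      { col      = colours L
      ; edge     = edges L
      ; oriented = λ u v w p → zero-unless (colours L w u) λ q →
          disjoint (0<χ⇒∈ (line-pos (rowLines L u) v p)) (0<χ⇒∈ (line-pos (colLines L u) w q))
      ; out-inj  = λ u → injective (rowLines L u)
      ; out-int  = λ u a b x p l r → full (rowLines L u) (line-pos (rowLines L u) a p) x (≤-trans p l)
                     (≤-trans r (bounded (rowLines L u) b))
      ; in-inj   = λ v → injective (colLines L v)
      ; in-int   = λ v a b x p l r → full (colLines L v) (line-pos (colLines L v) a p) x (≤-trans p l)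
                     (≤-trans r (bounded (colLines L v) b))
      }
      where
      zero-unless : ∀ x → ¬ (0 < x) → x ≡ 0
      zero-unless zero    _ = refl
      zero-unless (suc x) p = contradiction z<s p

  module _ {s : ℕ} (D : DensePair G A B s) (53≤s : 53 ≤ s) (0<E : 0 < e G A B) where

    used : ∀ {k} → Layers k → Fin n → Fin n → ℕ
    used L u v = sg (colours L u v)

    usedʳ : ∀ {k} (L : Layers k) S T → between (used L) S T ≤ k * # T
    usedʳ {k} L S T = begin
      between (used L) S T                         ≡⟨ between-transpose (used L) S T ⟩
      ∑∈ T (λ v → ∑∈ S (λ u → used L u v))         ≤⟨ ∑∈-mono T (λ v _ → per v) ⟩
      ∑∈ T (λ _ → k)                               ≡⟨ ∑∈-const T k ⟩
      k * # T                                      ∎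
      where
      open ≤-Reasoning
      per : ∀ v → ∑∈ S (λ u → used L u v) ≤ k
      per v = ≤-trans (∑∈≤∑ S (λ u → used L u v)) (≤-trans (≤-reflexive (count (colLines L v)))
        (≤-trans (*-monoʳ-≤ k (χ≤1 B v)) (≤-reflexive (*-identityʳ k))))

    usedˡ : ∀ {k} (L : Layers k) S T → between (used L) S T ≤ k * # S
    usedˡ {k} L S T = begin
      between (used L) S T   ≤⟨ ∑∈-mono S (λ u _ → per u) ⟩
      ∑∈ S (λ _ → k)         ≡⟨ ∑∈-const S k ⟩
      k * # S                ∎
      where
      open ≤-Reasoning
      per : ∀ u → ∑∈ T (used L u) ≤ k
      per u = ≤-trans (∑∈≤∑ T (used L u)) (≤-trans (≤-reflexive (count (rowLines L u)))
        (≤-trans (*-monoʳ-≤ k (χ≤1 A u)) (≤-reflexive (*-identityʳ k))))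

    -- Here `c` is |S| or |T|. With k < E/(100 s), the at most k c used pairs are fewer than the E
    -- c/(100 s) edges that expansion provides.
    few-used : ∀ k c x y → 100 * (s * k) < e G A B → 0 < c → e G A B * c ≤ 100 * (s * x) → y ≤ k * c → y < x
    few-used k c x y small 0<c large few = *-cancelˡ-< (100 * s) y x (begin-strict
      100 * s * y              ≤⟨ *-monoʳ-≤ (100 * s) few ⟩
      100 * s * (k * c)        ≡⟨ shape 100 s k c ⟩
      100 * (s * k) * c        <⟨ *-monoˡ-< c {{>-nonZero 0<c}} small ⟩
      e G A B * c              ≤⟨ large ⟩
      100 * (s * x)            ≡⟨ sym (*-assoc 100 s x) ⟩
      100 * s * x              ∎)
      where
      open ≤-Reasoning
      shape : ∀ c s k b → c * s * (k * b) ≡ c * (s * k) * b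
      shape = solve 4 (λ c s k b → c :* s :* (k :* b) := c :* (s :* k) :* b) refl
        where open +-*-Solver

    -- From |S| + |T| > s follow |X| < |T|, |Y| < |S| and |X| + |Y| < s, so one of the complements
    -- `X`, `Y` has at most s/2 elements. `expansion` is applied from that side.
    unused-expanding : ∀ {k} (L : Layers k) → 100 * (s * k) < e G A B → Expanding {R = unused L} s A B
    unused-expanding {k} L small S T S⊆A T⊆B big =
      let u , v , u∈ , v∈ , lt = between<⇒∃ (used L) (weight G) S T more
      in u , v , u∈ , v∈ , unused-intro (adj G u v) (colours L u v) lt
      where
      unused-intro : ∀ b x → sg x < ⟦ b ⟧ → b ∧ (x ≡ᵇ 0) ≡ true
      unused-intro true zero _ = refl
      unused-intro true (suc _) (s≤s ())
      X = A ∖ S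
      Y = B ∖ T
      spA : Split A S X
      spA = ∖-split S⊆A
      spB : Split B T Y
      spB = ∖-split T⊆B
      cA : # S + # X ≡ s
      cA = trans (sym (split-card spA)) (DensePair.cardˡ D)
      cB : # T + # Y ≡ s
      cB = trans (sym (split-card spB)) (DensePair.cardʳ D)
      X<T : # X < # T
      X<T = +-cancelˡ-< (# S) _ _ (subst (_< # S + # T) (sym cA) big)
      Y<S : # Y < # S
      Y<S = +-cancelˡ-< (# T) _ _ (subst₂ _<_ (sym cB) (+-comm (# S) (# T)) big)
      more : between (used L) S T < e G S T
      more with 2 * # X ≤? s
      ... | yes 2X≤s = few-used k (# T) (e G S T) _ small (≤-trans (s≤s z≤n) X<T)
                         (expansion G D 53≤s 0<E spA T⊆B (<⇒≤ X<T) 2X≤s) (usedʳ L S T)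
      ... | no ¬2X≤s = few-used k (# S) (e G S T) _ small (≤-trans (s≤s z≤n) Y<S)
                         (subst₂ (λ x y → x * # S ≤ 100 * (s * y)) (e-comm G B A) (e-comm G T S)
                           (expansion G (densePair-swap G D) 53≤s (subst (0 <_) (e-comm G A B) 0<E) spB S⊆A (<⇒≤ Y<S) 2Y≤s))
                         (usedˡ L S T)
        where
        open ≤-Reasoning
        2Y≤s : 2 * # Y ≤ s
        2Y≤s = +-cancelʳ-≤ (2 * # X) _ _ (begin
          2 * # Y + 2 * # X     ≡⟨ sym (*-distribˡ-+ 2 (# Y) (# X)) ⟩
          2 * (# Y + # X)       ≤⟨ *-monoʳ-≤ 2 (+-monoˡ-≤ (# X) (<⇒≤ Y<S)) ⟩
          2 * (# S + # X)       ≡⟨ cong (2 *_) cA ⟩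
          2 * s                 ≡⟨ cong (s +_) (+-identityʳ s) ⟩
          s + s                 ≤⟨ +-monoʳ-≤ s (<⇒≤ (≰⇒> ¬2X≤s)) ⟩
          s + 2 * # X           ∎)

    -- `fuel + k` is invariant, so the loop ends at the latest when `k` reaches the initial sum;
    -- starting with E units of fuel is enough because s ≥ 1.
    layers-many : ∀ fuel {k} → Layers k → e G A B ≤ 100 * (s * (fuel + k)) →
      ∃[ k′ ] (Layers k′ × e G A B ≤ 100 * (s * k′))
    layers-many zero       {k} L enough = k , L , enough
    layers-many (suc fuel) {k} L enough with e G A B ≤? 100 * (s * k)
    ... | yes done = k , L , done
    ... | no ¬done = layers-many fuel
          (layers-suc L (hall s s ≤-refl (DensePair.cardˡ D) (DensePair.cardʳ D) (unused-expanding L (≰⇒> ¬done))))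
          (subst (λ x → e G A B ≤ 100 * (s * x)) (sym (+-suc fuel k)) enough)

    dense-piece : Σ (Piece G) λ P → e G A B ≤ 100 * size P
    dense-piece =
      let k , L , large = layers-many (e G A B) layers-zero enough
          P , sz = layers-piece L
      in P , subst (λ x → e G A B ≤ 100 * x) (sym (trans sz (trans (cong (k *_) (DensePair.cardˡ D)) (*-comm k s)))) large
      where
      E = e G A B
      open ≤-Reasoning
      enough : E ≤ 100 * (s * (E + 0))
      enough = begin
        E                    ≤⟨ m≤n*m E s {{>-nonZero (≤-trans (s≤s z≤n) 53≤s)}} ⟩
        s * E                ≡⟨ cong (s *_) (sym (+-identityʳ E)) ⟩
        s * (E + 0)          ≤⟨ m≤n*m _ 100 ⟩
        100 * (s * (E + 0))  ∎

-- A large piece in every graph with an edge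

balance-arith : ∀ a b N E E₀ → a ≤ N → b ≤ N → b * E ≤ a * E₀ → b ^ 5 * E ^ 3 ≤ N ^ 5 * E₀ ^ 3
balance-arith a b N E E₀ a≤N b≤N p = begin
  b ^ 5 * E ^ 3              ≡⟨ shape b E ⟩
  (b * E) ^ 3 * b ^ 2        ≤⟨ *-mono-≤ (^-monoˡ-≤ 3 (≤-trans p (*-monoˡ-≤ E₀ a≤N))) (^-monoˡ-≤ 2 b≤N) ⟩
  (N * E₀) ^ 3 * N ^ 2       ≡⟨ sym (shape N E₀) ⟩
  N ^ 5 * E₀ ^ 3             ∎
  where
  open ≤-Reasoning
  open +-*-Solver
  shape : ∀ b e → b ^ 5 * e ^ 3 ≡ (b * e) ^ 3 * b ^ 2
  shape = solve 2 (λ b e → b :^ 5 :* e :^ 3 := (b :* e) :^ 3 :* b :^ 2) refl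

-- Squaring the density comparison gives s^10 E₁^6 ≤ N^10 E^6, and s² ≥ E replaces s^10 by E^5,
-- which cancels. This removes the unknown size `s`.
volume-arith : ∀ s N V E₁ E → 0 < E → V ≤ 4 * E₁ → s ^ 5 * E₁ ^ 3 ≤ N ^ 5 * E ^ 3 → E ≤ s * s →
  V ^ 6 ≤ 4 ^ 6 * (E * N ^ 10)
volume-arith s N V E₁ E 0<E V≤ dense E≤ = *-cancelˡ-≤ (E ^ 5) {{>-nonZero (^-pos 5 0<E)}} (begin
  E ^ 5 * V ^ 6                        ≤⟨ *-mono-≤ (^-monoˡ-≤ 5 E≤) (^-monoˡ-≤ 6 V≤) ⟩
  (s * s) ^ 5 * (4 * E₁) ^ 6           ≡⟨ shape₁ s 4 E₁ ⟩
  4 ^ 6 * (s ^ 5 * E₁ ^ 3) ^ 2         ≤⟨ *-monoʳ-≤ (4 ^ 6) (^-monoˡ-≤ 2 dense) ⟩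
  4 ^ 6 * (N ^ 5 * E ^ 3) ^ 2          ≡⟨ shape₂ N 4 E ⟩
  E ^ 5 * (4 ^ 6 * (E * N ^ 10))       ∎)
  where
  open ≤-Reasoning
  open +-*-Solver
  shape₁ : ∀ s c e → (s * s) ^ 5 * (c * e) ^ 6 ≡ c ^ 6 * (s ^ 5 * e ^ 3) ^ 2
  shape₁ = solve 3 (λ s c e → (s :* s) :^ 5 :* (c :* e) :^ 6 := c :^ 6 :* (s :^ 5 :* e :^ 3) :^ 2) refl
  shape₂ : ∀ N c e → c ^ 6 * (N ^ 5 * e ^ 3) ^ 2 ≡ e ^ 5 * (c ^ 6 * (e * N ^ 10))
  shape₂ = solve 3 (λ N c e → c :^ 6 :* (N :^ 5 :* e :^ 3) :^ 2 := e :^ 5 :* (c :^ 6 :* (e :* N :^ 10))) refl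

pos-of-^3 : ∀ {a x y} → 0 < a → a ≤ x * y ^ 3 → 0 < y
pos-of-^3 {a} {x} {zero}  p q = contradiction (≤-trans p (≤-trans q (≤-reflexive (*-zeroʳ x)))) λ ()
pos-of-^3 {a} {x} {suc y} p q = z<s

module _ (G : Graph n) where

  private
    V = nonIsolated G
    N = # V

  record BalancedPair (A B : Subset n) : Set where
    field
      {A₀ B₀} : Subset n
      {s}     : ℕ
      A₀⊆A    : A₀ ⊆ A
      B₀⊆B    : B₀ ⊆ B
      cardA₀  : # A₀ ≡ s
      cardB₀  : # B₀ ≡ s
      0<s     : 0 < s
      heavy   : s ^ 5 * e G A B ^ 3 ≤ N ^ 5 * e G A₀ B₀ ^ 3

  -- The larger side, of size a ≤ N, is trimmed to the size s of the smaller without lowering its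
  -- average degree. Then E₀ ≥ (s/a) E, so E₀³/s⁵ ≥ E³/(a³ s²) ≥ E³/N⁵.
  balance : ∀ A B → A ⊆ V → B ⊆ V → 0 < e G A B → BalancedPair A B
  balance A B A⊆V B⊆V 0<e with ≤-total (# B) (# A)
  ... | inj₁ B≤A =
    let A₀ , A₀⊆A , c , h = ∃-heavy-subset (# A ∸ # B) (# B) A (λ u → ∑∈ B (weight G u)) (sym (m∸n+n≡m B≤A))
    in record { A₀⊆A = A₀⊆A ; B₀⊆B = ⊆-refl ; cardA₀ = c ; cardB₀ = refl
              ; 0<s = n≢0⇒n>0 λ z → contradiction (≤-trans 0<e (≤-trans (e≤ G A B) (≤-reflexive (trans (cong (# A *_) z) (*-zeroʳ (# A)))))) λ ()
              ; heavy = balance-arith (# A) (# B) N (e G A B) (e G A₀ B) (#-mono A⊆V) (#-mono B⊆V) h }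
  ... | inj₂ A≤B =
    let B₀ , B₀⊆B , c , h = ∃-heavy-subset (# B ∸ # A) (# A) B (λ v → ∑∈ A (weight G v)) (sym (m∸n+n≡m A≤B))
    in record { A₀⊆A = ⊆-refl ; B₀⊆B = B₀⊆B ; cardA₀ = refl ; cardB₀ = c
              ; 0<s = n≢0⇒n>0 λ z → contradiction (≤-trans 0<e (≤-trans (e≤ G A B) (≤-reflexive (cong (_* # B) z)))) λ ()
              ; heavy = balance-arith (# B) (# A) N (e G A B) (e G A B₀) (#-mono B⊆V) (#-mono A⊆V)
                          (subst₂ (λ x y → # A * x ≤ # B * y) (e-comm G B A) (e-comm G B₀ A) h) }

  record Candidate : Set where
    field
      {A B}    : Subset n
      {s}      : ℕ
      disjoint : Disjoint A B
      dense    : DensePair G A B s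
      0<E      : 0 < e G A B
      large    : volume G ^ 6 ≤ 4 ^ 6 * (e G A B * N ^ 10)

  candidate-from : ∀ {A B} → Disjoint A B → 0 < e G A B → volume G ≤ 4 * e G A B →
    (b : BalancedPair A B) → DenseSubpair G (BalancedPair.A₀ b) (BalancedPair.B₀ b) (BalancedPair.s b) → Candidate
  candidate-from {A} {B} disjoint 0<e vol≤ b d = record
    { disjoint = λ p q → disjoint (A₀⊆A (A′⊆A p)) (B₀⊆B (B′⊆B q))
    ; dense    = dense
    ; 0<E      = 0<E
    ; large    = volume-arith s′ N (volume G) (e G A B) (e G A′ B′) 0<E vol≤ ratio E≤s²
    }
    where
    open BalancedPair b
    open DenseSubpair d
    0<s′ : 0 < s′
    0<s′ = 0<s⇒0<s′ 0<s
    0<e₀ : 0 < e G A₀ B₀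
    0<e₀ = pos-of-^3 {x = N ^ 5} (*-mono-≤ (^-pos 5 0<s) (^-pos 3 0<e)) heavy
    0<E : 0 < e G A′ B′
    0<E = pos-of-^3 {x = s ^ 5} (*-mono-≤ (^-pos 5 0<s′) (^-pos 3 0<e₀)) denser
    ratio : s′ ^ 5 * e G A B ^ 3 ≤ N ^ 5 * e G A′ B′ ^ 3
    ratio = ≤-compose-ratios (s′ ^ 5) (N ^ 5) (s ^ 5) (e G A B ^ 3) (e G A₀ B₀ ^ 3) (e G A′ B′ ^ 3)
      (λ z → contradiction z (>⇒≢ (^-pos 5 0<s))) heavy denser
    E≤s² : e G A′ B′ ≤ s′ * s′
    E≤s² = ≤-trans (e≤ G A′ B′) (≤-reflexive (cong₂ _*_ (DensePair.cardˡ dense) (DensePair.cardʳ dense)))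

  candidate : 0 < volume G → Candidate
  candidate 0<vol = from-cut (directed-cut (weight G) loop V ends)
    where
    loop : ∀ u → weight G u u ≡ 0
    loop u = cong ⟦_⟧ (irrefl G u)
    ends : ∀ u v → 0 < weight G u v → u ∈ V × v ∈ V
    ends u v p = edge⇒nonIsolated G u v (0<⟦⟧ p) , edge⇒nonIsolated G v u (trans (Graph.sym G v u) (0<⟦⟧ p))
    from-cut : (∃₂ λ A B → A ⊆ V × B ⊆ V × Disjoint A B × volume G ≤ 4 * e G A B) → Candidate
    from-cut (A , B , A⊆V , B⊆V , disjoint , vol≤) = candidate-from disjoint 0<e vol≤ b
      (∃-densePair G _ _ (BalancedPair.A₀ b) (BalancedPair.B₀ b) ≤-refl (BalancedPair.cardA₀ b) (BalancedPair.cardB₀ b))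
      where
      0<e : 0 < e G A B
      0<e = n≢0⇒n>0 λ z → contradiction (≤-trans 0<vol (≤-trans vol≤ (≤-reflexive (cong (4 *_) z)))) λ ()
      b : BalancedPair A B
      b = balance A B A⊆V B⊆V 0<e

  -- If s ≤ 52 then E ≤ 52² is a constant, and the star forest alone suffices, having at least one
  -- edge. Otherwise the larger of star forest and dense piece satisfies both bounds.
  large-piece : ∀ c → 100 ≤ c → 52 * 52 ≤ c → 0 < volume G → Σ (Piece G) λ P →
    N ≤ 4 * size P × volume G ^ 6 ≤ 4 ^ 6 * (c * size P * N ^ 10)
  large-piece c 100≤c 52²≤c 0<vol = finish (candidate 0<vol) (star-forest G)
    where
    0<N : 0 < N
    0<N = let u , p = 0<∑⇒∃ (λ u → ∑ (weight G u)) 0<vol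
              v , q = 0<∑⇒∃ (weight G u) p
              u∈ = edge⇒nonIsolated G u v (0<⟦⟧ q)
          in ≤-trans (≤-reflexive (sym (∈⇒χ u∈))) (f≤∑f (χ V) u)
    finish : Candidate → (Σ (Piece G) λ P → N ≤ 4 * size P) → Σ (Piece G) λ P →
      N ≤ 4 * size P × volume G ^ 6 ≤ 4 ^ 6 * (c * size P * N ^ 10)
    finish C (Q , N≤) = conclude pick
      where
      open Candidate C
      E = e G A B
      0<Q : 0 < size Q
      0<Q = n≢0⇒n>0 λ z → contradiction (≤-trans 0<N (≤-trans N≤ (≤-reflexive (cong (4 *_) z)))) λ ()
      pick : Σ (Piece G) λ P → N ≤ 4 * size P × E ≤ c * size P
      pick with 53 ≤? s
      ... | no s<53 = Q , N≤ , (begin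
          E               ≤⟨ e≤ G A B ⟩
          # A * # B       ≡⟨ cong₂ _*_ (DensePair.cardˡ dense) (DensePair.cardʳ dense) ⟩
          s * s           ≤⟨ *-mono-≤ s≤52 s≤52 ⟩
          52 * 52         ≤⟨ 52²≤c ⟩
          c               ≤⟨ m≤m*n c (size Q) {{>-nonZero 0<Q}} ⟩
          c * size Q      ∎)
        where
        open ≤-Reasoning
        s≤52 : s ≤ 52
        s≤52 = s≤s⁻¹ (≰⇒> s<53)
      ... | yes 53≤s = larger (dense-piece G A B disjoint dense 53≤s 0<E)
        where
        larger : (Σ (Piece G) λ P → E ≤ 100 * size P) → Σ (Piece G) λ P → N ≤ 4 * size P × E ≤ c * size P
        larger (P , E≤) with ≤-total (size P) (size Q)
        ... | inj₁ le = Q , N≤ , ≤-trans E≤ (*-mono-≤ 100≤c le)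
        ... | inj₂ le = P , ≤-trans N≤ (*-monoʳ-≤ 4 le) , ≤-trans E≤ (*-monoˡ-≤ (size P) 100≤c)
      conclude : (Σ (Piece G) λ P → N ≤ 4 * size P × E ≤ c * size P) → Σ (Piece G) λ P →
        N ≤ 4 * size P × volume G ^ 6 ≤ 4 ^ 6 * (c * size P * N ^ 10)
      conclude (P , N≤′ , E≤) = P , N≤′ , ≤-trans large (*-monoʳ-≤ (4 ^ 6) (*-monoˡ-≤ (N ^ 10) E≤))

-- Growth of powers

^-distribʳ-* : ∀ k x y → (x * y) ^ k ≡ x ^ k * y ^ k
^-distribʳ-* zero    x y = refl
^-distribʳ-* (suc k) x y = trans (cong (x * y *_) (^-distribʳ-* k x y)) (interchange x y (x ^ k) (y ^ k))
  where
  open +-*-Solver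
  interchange : ∀ a b c d → a * b * (c * d) ≡ a * c * (b * d)
  interchange = solve 4 (λ a b c d → a :* b :* (c :* d) := a :* c :* (b :* d)) refl

1+n≤2^n : ∀ k → suc k ≤ 2 ^ k
1+n≤2^n zero    = ≤-refl
1+n≤2^n (suc k) = +-mono-≤ (m^n>0 2 k) (≤-trans (1+n≤2^n k) (≤-reflexive (sym (+-identityʳ _))))

-- With D = d + 1 and i = ⌊j / D⌋, the bounds C D^d ≤ i < 2^i and j < D (i + 1) ≤ D 2^i
-- give C j^d ≤ 2^i (2^i)^d ≤ 2^j.
exp-beats-poly : ∀ C d → ∃[ J₀ ] (∀ j → J₀ ≤ j → C * j ^ d ≤ 2 ^ j)
exp-beats-poly C d = M * D , bound
  where
  D = suc d
  M = C * D ^ d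
  open ≤-Reasoning
  bound : ∀ j → M * D ≤ j → C * j ^ d ≤ 2 ^ j
  bound j MD≤j = begin
    C * j ^ d                       ≤⟨ *-monoʳ-≤ C (^-monoˡ-≤ d j≤) ⟩
    C * (D * 2 ^ i) ^ d             ≡⟨ cong (C *_) (^-distribʳ-* d D (2 ^ i)) ⟩
    C * (D ^ d * (2 ^ i) ^ d)       ≡⟨ sym (*-assoc C (D ^ d) ((2 ^ i) ^ d)) ⟩
    M * (2 ^ i) ^ d                 ≤⟨ *-monoˡ-≤ ((2 ^ i) ^ d) (≤-trans M≤i (≤-trans (n≤1+n i) (1+n≤2^n i))) ⟩
    2 ^ i * (2 ^ i) ^ d             ≡⟨ ^-*-assoc 2 i D ⟩
    2 ^ (i * D)                     ≤⟨ ^-monoʳ-≤ 2 (m/n*n≤m j D) ⟩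
    2 ^ j                           ∎
    where
    i = j / D
    M≤i : M ≤ i
    M≤i = ≤-trans (≤-reflexive (sym (m*n/n≡m M D))) (/-monoˡ-≤ D MD≤j)
    j≤ : j ≤ D * 2 ^ i
    j≤ = begin
      j                    ≡⟨ m≡m%n+[m/n]*n j D ⟩
      j % D + i * D        ≤⟨ +-monoˡ-≤ (i * D) (<⇒≤ (m%n<n j D)) ⟩
      D + i * D            ≡⟨ *-comm (suc i) D ⟩
      D * suc i            ≤⟨ *-monoʳ-≤ D (1+n≤2^n i) ⟩
      D * 2 ^ i            ∎

-- Squared, the claim reads C² j^(2d) ≤ x², and x² is at least 2^j / 2; hence the parameters 2 C²
-- and 2 d of `growth`. Values of `j` below J₀ are absorbed by the threshold for `x`.
polylog-bound : ∀ C d → ∃[ N ] (∀ x j → N ≤ x → 2 ^ j ≤ 2 * (x * x) → C * j ^ d ≤ x)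
polylog-bound C d = C * J₀ ^ d , bound
  where
  growth = exp-beats-poly (2 * (C * C)) (d + d)
  J₀ = proj₁ growth
  open ≤-Reasoning
  bound : ∀ x j → C * J₀ ^ d ≤ x → 2 ^ j ≤ 2 * (x * x) → C * j ^ d ≤ x
  bound x j N≤x 2^j≤ with ≤-total j J₀
  ... | inj₁ j≤J₀ = ≤-trans (*-monoʳ-≤ C (^-monoˡ-≤ d j≤J₀)) N≤x
  ... | inj₂ J₀≤j = square-cancel (*-cancelˡ-≤ 2 (begin
      2 * (C * j ^ d * (C * j ^ d))    ≡⟨ shape C (j ^ d) ⟩
      2 * (C * C) * (j ^ d * j ^ d)    ≡⟨ cong (2 * (C * C) *_) (sym (^-distribˡ-+-* j d d)) ⟩
      2 * (C * C) * j ^ (d + d)        ≤⟨ proj₂ growth j J₀≤j ⟩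
      2 ^ j                            ≤⟨ 2^j≤ ⟩
      2 * (x * x)                      ∎))
    where
    shape : ∀ c y → 2 * (c * y * (c * y)) ≡ 2 * (c * c) * (y * y)
    shape = solve 2 (λ c y → con 2 :* (c :* y :* (c :* y)) := con 2 :* (c :* c) :* (y :* y)) refl
      where open +-*-Solver
    square-cancel : ∀ {a b} → a * a ≤ b * b → a ≤ b
    square-cancel {a} {b} p = ≮⇒≥ λ b<a → <⇒≱ (*-mono-< b<a b<a) p

∃-root : ∀ k .{{_ : NonZero k}} Q → ∃[ r ] (r ^ k ≤ Q × Q < suc r ^ k)
∃-root k@(suc _) zero    = 0 , z≤n , ≤-reflexive (sym (^-zeroˡ k))
∃-root k         (suc Q) with ∃-root k Q
... | r , le , lt with suc r ^ k ≤? suc Q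
...   | yes p = suc r , p , ≤-<-trans lt (^-monoˡ-< k (n<1+n (suc r)))
...   | no p  = r , m≤n⇒m≤1+n le , ≰⇒> p

-- Rounding the root up costs at most a factor 2, since the floor of the root is at least 1.
∃-root-above : ∀ k .{{_ : NonZero k}} Q → 0 < Q → ∃[ q ] (0 < q × Q ≤ q ^ k × q ^ k ≤ 2 ^ k * Q)
∃-root-above k Q 0<Q with ∃-root k Q
... | zero  , _  , lt = contradiction (≤-trans lt (≤-reflexive (^-zeroˡ k))) (<⇒≱ (s≤s 0<Q))
... | suc r , le , lt = suc (suc r) , z<s , <⇒≤ lt , (begin
    suc (suc r) ^ k        ≤⟨ ^-monoˡ-≤ k (s≤s (≤-trans (≤-reflexive (+-comm 1 r)) (+-monoʳ-≤ r (s≤s z≤n)))) ⟩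
    (2 * suc r) ^ k        ≡⟨ ^-distribʳ-* k 2 (suc r) ⟩
    2 ^ k * suc r ^ k      ≤⟨ *-monoʳ-≤ (2 ^ k) le ⟩
    2 ^ k * Q              ∎)
  where open ≤-Reasoning

∃-log : ∀ W → 0 < W → ∃[ j ] (W < 2 ^ j × 2 ^ j ≤ 2 * W)
∃-log (suc zero)        _ = 1 , s≤s (s≤s z≤n) , ≤-refl
∃-log (suc W@(suc _)) _ with ∃-log W z<s
... | j , lt , le with suc W <? 2 ^ j
...   | yes p = j , p , ≤-trans le (*-monoʳ-≤ 2 (n≤1+n W))
...   | no p  = suc j , ≤-<-trans lt (^-monoʳ-< 2 (s≤s (s≤s z≤n)) (n<1+n j)) , *-monoʳ-≤ 2 (≮⇒≥ p)

-- Thickness from large pieces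

thickness-pos : {G : Graph n} → ∀ t → 0 < t → Thick G t → ThicknessAtMost G t
thickness-pos {G = G} (suc t) _ = thick⇒thickness {G = G}

-- `Q` and `W` stay fixed while the graph shrinks, so the hypothesis must cover every graph of
-- volume at most `W`. With `q` the rounded root of `Q`, each piece takes at least a fraction 1/q of
-- the volume.
greedy : ∀ k .{{_ : NonZero k}} Q W → 0 < Q → 0 < W →
  (∀ (G : Graph n) → volume G ≤ W → 0 < volume G → Σ (Piece G) λ P → volume G ^ k ≤ Q * size P ^ k) →
  ∀ G → volume G ≤ W → ∃₂ λ q j → q ^ k ≤ 2 ^ k * Q × 2 ^ j ≤ 2 * W × ThicknessAtMost G (j * q)
greedy k Q W 0<Q 0<W large G vol≤ with ∃-root-above k Q 0<Q | ∃-log W 0<W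
... | q , 0<q , Q≤ , q≤ | j , W< , 2^j≤ = q , j , q≤ , 2^j≤ ,
  thickness-pos {G = G} (j * q) (*-mono-≤ 0<j 0<q)
    (thick-log (λ H → volume H ≤ W) q step 0<q j G vol≤ (≤-<-trans vol≤ W<))
  where
  0<j : 0 < j
  0<j = n≢0⇒n>0 λ z → contradiction (≤-trans W< (≤-reflexive (cong (2 ^_) z))) (<⇒≱ (s≤s 0<W))
  step : ∀ H → volume H ≤ W → 0 < volume H → Σ (Piece H) λ P → volume H ≤ q * size P × volume (removePiece P) ≤ W
  step H H≤ 0<H with large H H≤ 0<H
  ... | P , le = P
    , ^-cancelʳ-≤ k (≤-trans le (≤-trans (*-monoˡ-≤ (size P ^ k) Q≤) (≤-reflexive (sym (^-distribʳ-* k q (size P))))))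
    , ≤-trans (m≤m+n (volume (removePiece P)) (size P)) (≤-trans (removePiece-volume P) H≤)

power-arith : ∀ k a K j q D x y → q ^ k ≤ D * x ^ a → D ^ K * j ^ (k * K) ≤ y → (j * q) ^ (k * K) ≤ x ^ (a * K) * y
power-arith k a K j q D x y q≤ ≤y = begin
  (j * q) ^ (k * K)                        ≡⟨ ^-distribʳ-* (k * K) j q ⟩
  j ^ (k * K) * q ^ (k * K)                ≡⟨ cong (j ^ (k * K) *_) (sym (^-*-assoc q k K)) ⟩
  j ^ (k * K) * (q ^ k) ^ K                ≤⟨ *-monoʳ-≤ (j ^ (k * K)) (^-monoˡ-≤ K q≤) ⟩
  j ^ (k * K) * (D * x ^ a) ^ K            ≡⟨ cong (j ^ (k * K) *_) (^-distribʳ-* K D (x ^ a)) ⟩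
  j ^ (k * K) * (D ^ K * (x ^ a) ^ K)      ≡⟨ cong (λ z → j ^ (k * K) * (D ^ K * z)) (^-*-assoc x a K) ⟩
  j ^ (k * K) * (D ^ K * x ^ (a * K))      ≡⟨ shape (j ^ (k * K)) (D ^ K) (x ^ (a * K)) ⟩
  x ^ (a * K) * (D ^ K * j ^ (k * K))      ≤⟨ *-monoʳ-≤ (x ^ (a * K)) ≤y ⟩
  x ^ (a * K) * y                          ∎
  where
  open ≤-Reasoning
  open +-*-Solver
  shape : ∀ u v w → u * (v * w) ≡ w * (v * u)
  shape = solve 3 (λ u v w → u :* (v :* w) := w :* (v :* u)) refl

x≤x^ : ∀ {x} k .{{_ : NonZero k}} → x ≤ x ^ k
x≤x^ {zero}      k       = z≤n
x≤x^ {x@(suc _)} (suc k) = m≤m*n x (x ^ k) {{>-nonZero (^-pos k z<s)}}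

-- The bound on V^6 is used twice, estimating N once by n and once by k f.
vertex-arith : ∀ k c n V f N → V ^ 6 ≤ c * (f * N ^ 10) → N ≤ k * f → N ≤ n →
  V ^ 12 ≤ c * c * k ^ 10 * n ^ 10 * f ^ 12
vertex-arith k c n V f N V≤ N≤kf N≤n = begin
  V ^ 12                                          ≡⟨ ^-distribˡ-+-* V 6 6 ⟩
  V ^ 6 * V ^ 6                                   ≤⟨ *-mono-≤ (≤-trans V≤ (*-monoʳ-≤ c (*-monoʳ-≤ f (^-monoˡ-≤ 10 N≤n))))
                                                             (≤-trans V≤ (*-monoʳ-≤ c (*-monoʳ-≤ f (^-monoˡ-≤ 10 N≤kf)))) ⟩
  c * (f * n ^ 10) * (c * (f * (k * f) ^ 10))     ≡⟨ cong (λ z → c * (f * n ^ 10) * (c * (f * z))) (^-distribʳ-* 10 k f) ⟩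
  c * (f * n ^ 10) * (c * (f * (k ^ 10 * f ^ 10))) ≡⟨ shape c f (n ^ 10) (k ^ 10) (f ^ 10) ⟩
  c * c * k ^ 10 * n ^ 10 * f ^ 12                ∎
  where
  open ≤-Reasoning
  open +-*-Solver
  shape : ∀ c f n k g → c * (f * n) * (c * (f * (k * g))) ≡ c * c * k * n * (f * (f * g))
  shape = solve 5 (λ c f n k g → c :* (f :* n) :* (c :* (f :* (k :* g))) := c :* c :* k :* n :* (f :* (f :* g))) refl

-- With N ≤ k f the bound becomes V^6 = O(f^11); five more factors V are paid for by V ≤ 2 m.
edge-arith : ∀ k c m V f N → V ^ 6 ≤ c * (f * N ^ 10) → N ≤ k * f → V ≤ 2 * m →
  V ^ 11 ≤ c * k ^ 10 * 2 ^ 5 * m ^ 5 * f ^ 11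
edge-arith k c m V f N V≤ N≤kf V≤2m = begin
  V ^ 11                                        ≡⟨ ^-distribˡ-+-* V 6 5 ⟩
  V ^ 6 * V ^ 5                                 ≤⟨ *-mono-≤ (≤-trans V≤ (*-monoʳ-≤ c (*-monoʳ-≤ f (^-monoˡ-≤ 10 N≤kf))))
                                                           (^-monoˡ-≤ 5 V≤2m) ⟩
  c * (f * (k * f) ^ 10) * (2 * m) ^ 5          ≡⟨ cong₂ (λ y z → c * (f * y) * z) (^-distribʳ-* 10 k f) (^-distribʳ-* 5 2 m) ⟩
  c * (f * (k ^ 10 * f ^ 10)) * (2 ^ 5 * m ^ 5) ≡⟨ shape c f (k ^ 10) (f ^ 10) (2 ^ 5) (m ^ 5) ⟩
  c * k ^ 10 * 2 ^ 5 * m ^ 5 * f ^ 11           ∎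
  where
  open ≤-Reasoning
  open +-*-Solver
  shape : ∀ c f k g d m → c * (f * (k * g)) * (d * m) ≡ c * k * d * m * (f * g)
  shape = solve 6 (λ c f k g d m → c :* (f :* (k :* g)) :* (d :* m) := c :* k :* d :* m :* (f :* g)) refl

-- The bounds in terms of n and of m

∑-bound : ∀ {n} (f : Fin n → ℕ) b → (∀ i → f i ≤ b) → ∑ f ≤ n * b
∑-bound {zero}  f b p = z≤n
∑-bound {suc n} f b p = +-mono-≤ (p zero) (∑-bound (f ∘ suc) b (p ∘ suc))

volume≤n² : (G : Graph n) → volume G ≤ n * n
volume≤n² {n} G = ∑-bound _ n λ u → ≤-trans (∑-bound _ 1 λ v → ⟦⟧≤1 (adj G u v)) (≤-reflexive (*-identityʳ n))

sum-allFin : (f : Fin n → ℕ) → sum (List.map f (allFin n)) ≡ ∑ f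
sum-allFin {n} f = trans (cong sum (List.map-tabulate (λ i → i) f)) (sum-tabulate f)
  where
  sum-tabulate : ∀ {m} (g : Fin m → ℕ) → sum (List.tabulate g) ≡ ∑ g
  sum-tabulate {zero}  g = refl
  sum-tabulate {suc m} g = cong (g zero +_) (sum-tabulate (g ∘ suc))

volume≤2edgeCount : (G : Graph n) → volume G ≤ 2 * edgeCount G
volume≤2edgeCount {n} G = begin
  volume G                                                     ≤⟨ ∑-mono (λ u → ∑-mono (λ v → pointwise u v)) ⟩
  ∑ (λ u → ∑ λ v → up u v + up v u)                            ≡⟨ ∑-cong (λ u → ∑-+ (up u) (λ v → up v u)) ⟩
  ∑ (λ u → ∑ (up u) + ∑ (λ v → up v u))                        ≡⟨ ∑-+ (λ u → ∑ (up u)) (λ u → ∑ (λ v → up v u)) ⟩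
  ∑ (λ u → ∑ (up u)) + ∑ (λ u → ∑ (λ v → up v u))              ≡⟨ cong (∑ (λ u → ∑ (up u)) +_) (sym (∑-swap up)) ⟩
  ∑ (λ u → ∑ (up u)) + ∑ (λ u → ∑ (up u))                      ≡⟨ cong₂ _+_ (sym count-eq) (trans (sym count-eq) (sym (+-identityʳ _))) ⟩
  2 * edgeCount G                                              ∎
  where
  open ≤-Reasoning
  up : Fin n → Fin n → ℕ
  up u v = if adj G u v ∧ ⌊ u Fin.<? v ⌋ then 1 else 0
  count-eq : edgeCount G ≡ ∑ (λ u → ∑ (up u))
  count-eq = trans (sum-allFin (λ u → sum (List.map (up u) (allFin n)))) (∑-cong λ u → sum-allFin (up u))
  pointwise : ∀ u v → ⟦ adj G u v ⟧ ≤ up u v + up v u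
  pointwise u v with adj G u v in eq
  ... | false = z≤n
  ... | true rewrite trans (Graph.sym G v u) eq with u Fin.<? v | v Fin.<? u
  ...   | yes _ | _     = s≤s z≤n
  ...   | no _  | yes _ = ≤-refl
  ...   | no p  | no q  = contradiction
            (trans (sym eq) (subst (λ w → adj G u w ≡ false) (Fin.toℕ-injective (≤-antisym (≮⇒≥ q) (≮⇒≥ p))) (irrefl G u)))
            λ ()

#≤n : (S : Subset n) → # S ≤ n
#≤n {n} S = ≤-trans (∑-bound (χ S) 1 (χ≤1 S)) (≤-reflexive (*-identityʳ n))

PieceBound : ℕ → ℕ → Set
PieceBound k c = ∀ {n} (G : Graph n) → 0 < volume G → Σ (Piece G) λ P →
  # (nonIsolated G) ≤ k * size P × volume G ^ 6 ≤ c * (size P * # (nonIsolated G) ^ 10)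

∃-pieceBound : ∃[ c ] (0 < c × PieceBound 4 c)
∃-pieceBound = 4 ^ 6 * (52 * 52) , ≤ᵇ⇒≤ 1 (4 ^ 6 * (52 * 52)) tt , λ G 0<vol → rearrange G (52 * 52) (4 ^ 6)
    (large-piece G (52 * 52) (≤ᵇ⇒≤ 100 (52 * 52) tt) ≤-refl 0<vol)
  where
  rearrange : ∀ {n} (G : Graph n) c d →
    (Σ (Piece G) λ P → # (nonIsolated G) ≤ 4 * size P × volume G ^ 6 ≤ d * (c * size P * # (nonIsolated G) ^ 10)) →
    Σ (Piece G) λ P → # (nonIsolated G) ≤ 4 * size P × volume G ^ 6 ≤ d * c * (size P * # (nonIsolated G) ^ 10)
  rearrange G c d (P , N≤ , le) = P , N≤ , ≤-trans le (≤-reflexive (shape c d (size P) (# (nonIsolated G) ^ 10)))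
    where
    open +-*-Solver
    shape : ∀ c d f N → d * (c * f * N) ≡ d * c * (f * N)
    shape = solve 4 (λ c d f N → d :* (c :* f :* N) := d :* c :* (f :* N)) refl

-- For 2^j ≤ 2x² the factor j^k is polylogarithmic in x.
thickness-arith : ∀ k a D K → ∃[ N ] (∀ x j q → N ≤ x → 2 ^ j ≤ 2 * (x * x) → q ^ k ≤ 2 ^ k * (D * x ^ a) →
  (j * q) ^ (k * K) ≤ x ^ (a * K) * x)
thickness-arith k a D K =
  let N , small = polylog-bound ((2 ^ k * D) ^ K) (k * K)
  in N , λ x j q N≤x 2^j≤ q≤ → power-arith k a K j q (2 ^ k * D) x x
           (≤-trans q≤ (≤-reflexive (sym (*-assoc (2 ^ k) D (x ^ a))))) (small x j N≤x 2^j≤)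

-- After taking roots, t ≤ n^(5/6 + 1/(K + 1)), which is how o(1) is rendered. Raised to the power
-- 12 (K + 1), the logarithmic factor costs a single factor n, where n^12 is allowed.
vertex-bound : ∀ D → 0 < D →
  (∀ n (G : Graph n) → 0 < volume G → Σ (Piece G) λ P → volume G ^ 12 ≤ D * n ^ 10 * size P ^ 12) →
  ∀ K → ∃[ N ] (∀ n → N ≤ n → (G : Graph n) →
    ∃[ t ] (t ^ (6 * suc K) ≤ n ^ (5 * suc K + 6) × ThicknessAtMost G t))
vertex-bound D 0<D piece K =
  let N , small = thickness-arith 12 10 D (suc K)
  in suc N , λ n N<n G →
       let 0<n = ≤-trans (s≤s z≤n) N<n
           q , j , q≤ , 2^j≤ , thin = greedy 12 (D * n ^ 10) (n * n) (*-mono-≤ 0<D (^-pos 10 0<n)) (*-mono-≤ 0<n 0<n)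
             (λ H _ → piece n H) G (volume≤n² G)
       in j * q , halve n (j * q) (suc K) (small n j q (<⇒≤ N<n) 2^j≤ q≤) , thin
  where
  halve : ∀ n t K → t ^ (12 * K) ≤ n ^ (10 * K) * n → t ^ (6 * K) ≤ n ^ (5 * K + 6)
  halve n t K le = ^-cancelʳ-≤ 2 (begin
    (t ^ (6 * K)) ^ 2          ≡⟨ ^-*-assoc t (6 * K) 2 ⟩
    t ^ (6 * K * 2)            ≡⟨ cong (t ^_) (double 6 K 2) ⟩
    t ^ (12 * K)               ≤⟨ le ⟩
    n ^ (10 * K) * n           ≤⟨ *-monoʳ-≤ (n ^ (10 * K)) (x≤x^ 12) ⟩
    n ^ (10 * K) * n ^ 12      ≡⟨ sym (^-distribˡ-+-* n (10 * K) 12) ⟩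
    n ^ (10 * K + 12)          ≡⟨ cong (λ x → n ^ (x + 12)) (sym (double 5 K 2)) ⟩
    n ^ (5 * K * 2 + 6 * 2)    ≡⟨ cong (n ^_) (sym (*-distribʳ-+ 2 (5 * K) 6)) ⟩
    n ^ ((5 * K + 6) * 2)      ≡⟨ sym (^-*-assoc n (5 * K + 6) 2) ⟩
    (n ^ (5 * K + 6)) ^ 2      ∎)
    where
    open ≤-Reasoning
    open +-*-Solver
    double : ∀ a x b → a * x * b ≡ a * b * x
    double = solve 3 (λ a x b → a :* x :* b := a :* b :* x) refl

edge-bound : ∀ D → 0 < D →
  (∀ n (G : Graph n) m → volume G ≤ 2 * m → 0 < volume G → Σ (Piece G) λ P → volume G ^ 11 ≤ D * m ^ 5 * size P ^ 11) →
  ∀ K → ∃[ M ] (∀ m → M ≤ m → ∀ n (G : Graph n) → edgeCount G ≡ m →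
    ∃[ t ] (t ^ (11 * suc K) ≤ m ^ (5 * suc K + 11) × ThicknessAtMost G t))
edge-bound D 0<D piece K =
  let M , small = thickness-arith 11 5 D (suc K)
  -- The condition m ≥ 2 gives 2 m ≤ m², so the bound W = 2 m fits the form 2^j ≤ 2 m² required by
  -- `small`.
  in 2 + M , λ m M<m n G count →
       let 2≤m = ≤-trans (s≤s (s≤s z≤n)) M<m
           0<m = <⇒≤ 2≤m
           q , j , q≤ , 2^j≤ , thin = greedy 11 (D * m ^ 5) (2 * m) (*-mono-≤ 0<D (^-pos 5 0<m)) (*-mono-≤ {1} {2} (s≤s z≤n) 0<m)
             (λ H → piece n H m) G (subst (λ x → volume G ≤ 2 * x) count (volume≤2edgeCount G))
       in j * q , widen m (j * q) (suc K)
                    (small m j q (≤-trans (m≤n+m M 2) M<m) (≤-trans 2^j≤ (*-monoʳ-≤ 2 (*-monoˡ-≤ m 2≤m))) q≤) , thin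
  where
  widen : ∀ m t K → t ^ (11 * K) ≤ m ^ (5 * K) * m → t ^ (11 * K) ≤ m ^ (5 * K + 11)
  widen m t K le = ≤-trans le (≤-trans (*-monoʳ-≤ (m ^ (5 * K)) (x≤x^ 11)) (≤-reflexive (sym (^-distribˡ-+-* m (5 * K) 11))))

bounds : ∀ k → 0 < k → ∃[ c ] (0 < c × PieceBound k c) →
  (∀ K → ∃[ N ] (∀ n → N ≤ n → (G : Graph n) →
    ∃[ t ] (t ^ (6 * suc K) ≤ n ^ (5 * suc K + 6) × ThicknessAtMost G t)))
  × (∀ K → ∃[ M ] (∀ m → M ≤ m → ∀ n (G : Graph n) → edgeCount G ≡ m →
    ∃[ t ] (t ^ (11 * suc K) ≤ m ^ (5 * suc K + 11) × ThicknessAtMost G t)))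
bounds k 0<k (c , 0<c , piece) =
    vertex-bound (c * c * k ^ 10) (*-mono-≤ (*-mono-≤ 0<c 0<c) (^-pos 10 0<k))
      (λ n G 0<vol → let P , N≤ , vol≤ = piece G 0<vol
                     in P , vertex-arith k c n (volume G) (size P) (# (nonIsolated G)) vol≤ N≤ (#≤n (nonIsolated G)))
  , edge-bound (c * k ^ 10 * 2 ^ 5) (*-mono-≤ (*-mono-≤ 0<c (^-pos 10 0<k)) (m^n>0 2 5))
      (λ n G m vol≤2m 0<vol → let P , N≤ , vol≤ = piece G 0<vol
                              in P , edge-arith k c m (volume G) (size P) (# (nonIsolated G)) vol≤ N≤ vol≤2m)

theorem1 : (∀ (K : ℕ) → ∃[ N ] (∀ (n : ℕ) → N ≤ n → (G : Graph n) →
    ∃[ t ] (t ^ (6 * suc K) ≤ n ^ (5 * suc K + 6) × ThicknessAtMost G t)))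
    ×
    (∀ (K : ℕ) → ∃[ M ] (∀ (m : ℕ) → M ≤ m → (n : ℕ) → (G : Graph n) → edgeCount G ≡ m →
    ∃[ t ] (t ^ (11 * suc K) ≤ m ^ (5 * suc K + 11) × ThicknessAtMost G t)))
theorem1 = bounds 4 (s≤s z≤n) ∃-pieceBound
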